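{- For every integer $r \ge 3$ and positive integers $s_1 \le s_2 \le \ldots \le s_r$, we have $$\mathrm{ex}(n, K_r, K_{s_1,s_2,\ldots, s_r}) = o\left(n^{r - 1/\prod_{i=1}^{r-1}s_i}\right) \quad \text{as } n \to \infty.$$
   Context: For graphs $F$ and $H$, the generalized Turán number $\mathrm{ex}(n,F,H)$ is the maximum number of (unlabeled) copies of $F$ in an $n$-vertex graph containing no subgraph isomorphic to $H$. $K_r$ denotes the complete graph on $r$ vertices, and $K_{s_1,\ldots,s_r}$ denotes the complete $r$-partite graph with parts of sizes $s_1,\ldots,s_r$. -}

module Defs where

open import Data.Nat using (ℕ; zero; suc; _+_; _*_; _≟_)
open import Data.Bool using (Bool; true; false; T; _∧_; _∨_; not; if_then_else_)
open import Data.Fin using (Fin; inject₁)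
import Data.Fin as F
open import Data.Fin.Subset using (Subset; ∣_∣)
open import Data.Vec using (Vec; []; _∷_; lookup)
open import Data.List using (List; []; _∷_; _++_; map; foldr; allFin)
open import Data.Bool.ListAction using (all)
open import Data.Nat.ListAction using (sum)
open import Data.Product using (Σ; proj₁; proj₂)
open import Relation.Binary.PropositionalEquality using (_≡_; _≢_)
open import Relation.Nullary.Decidable using (⌊_⌋)
open import Function.Definitions using (Injective)

record Graph (n : ℕ) : Set where
  field
    adj     : Fin n → Fin n → Bool
    adj-sym : ∀ i j → adj i j ≡ adj j i
    irrefl  : ∀ i → adj i i ≡ false
open Graph public

allSubsets : (n : ℕ) → List (Subset n)
allSubsets zero    = [] ∷ []
allSubsets (suc n) = map (true ∷_) (allSubsets n) ++ map (false ∷_) (allSubsets n)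

isCliqueB : ∀ {n} → Graph n → Subset n → Bool
isCliqueB {n} G S =
  all (λ i → all (λ j → not (lookup S i ∧ lookup S j ∧ not ⌊ i F.≟ j ⌋) ∨ adj G i j)
                 (allFin n))
      (allFin n)

copiesK : ∀ {n} → Graph n → ℕ → ℕ
copiesK {n} G r =
  sum (map (λ S → if ⌊ ∣ S ∣ ≟ r ⌋ ∧ isCliqueB G S then 1 else 0) (allSubsets n))

KVertex : (r : ℕ) → (Fin r → ℕ) → Set
KVertex r s = Σ (Fin r) (λ i → Fin (s i))

ContainsKpartite : ∀ {n} → Graph n → (r : ℕ) → (Fin r → ℕ) → Set
ContainsKpartite {n} G r s =
  Σ (KVertex r s → Fin n) λ f →
    Σ (Injective _≡_ _≡_ f) λ _ →
      ∀ (p q : KVertex r s) → proj₁ p ≢ proj₁ q → T (adj G (f p) (f q))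

prodButLast : (r : ℕ) → (Fin r → ℕ) → ℕ
prodButLast zero    s = 1
prodButLast (suc r) s = foldr _*_ 1 (map (λ i → s (inject₁ i)) (allFin r))

{-# OPTIONS --safe #-}
module Submission where

-- Let P = s₁⋯s_{r-1} and Σ = s₁ + … + s_{r-1}.  For a set H of r-tuples of vertices, iterating the
-- power mean inequality over the first r - 1 coordinates gives at least |H|^P n^{Σ+1} / n^{rP} pairs
-- (X, x), where X chooses s_i vertices, possibly repeated, for each part i < r, x is a single
-- vertex, and all resulting r-tuples lie in H.  If G is K_{s₁,…,s_r}-free and H consists of cliques,
-- then x takes fewer than s_r values when X has no repetition, and a choice X with repetitions,
-- though it allows up to n values, is rarer by a factor O(1/n); so there are only O(n^Σ) pairs.
--
-- To gain the little o, restrict H to the cliques whose first two vertices form a pair in a set E of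
-- at most δn² pairs: then X itself is confined to a proportion δ of all choices, and the bound drops
-- to O(δ n^Σ).  A set E meeting every r-clique is provided by the removal lemma, unless G has at
-- least c n^r cliques, in which case H = {all r-cliques} violates the O(n^Σ) bound for large n.
--
-- The removal lemma is proved by a one-sided regularity argument.  Pairs of cells of a partition are
-- alive or dead.  An alive pair (A, B) containing a sparse rectangle X × Y with |X||Y| ≥ |A||B|/q is
-- irregular; refining the partition by such rectangles for all irregular pairs at once and declaring
-- the rectangles dead loses few edges.  The alive area drops by more than n²/Lq as long as the
-- irregular pairs cover more than n²/L, so no energy function is needed.

open import Defs
open import Data.Nat using (ℕ; zero; suc; _+_; _*_; _^_; _∸_; _≤_; _<_; _⊔_; z≤n; s≤s; NonZero; >-nonZero; _≟_; _≤?_; _≤ᵇ_)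
open import Data.Nat.Properties
open import Data.Nat.ListAction using (sum)
open import Data.Nat.Tactic.RingSolver using (solve-∀)
open import Data.Bool using (Bool; true; false; T; _∧_; _∨_; not; if_then_else_)
open import Data.Bool.ListAction using (all)
open import Data.Bool.Properties using (T-∧; T-≡; T?; ∧-identityʳ; ∧-zeroʳ) renaming (_≟_ to _≟ᵇ_)
open import Data.Fin using (Fin; zero; suc; inject₁; fromℕ<; combine; remQuot; funToFin; finToFun)
import Data.Fin as F
import Data.Fin.Properties as F
open import Data.Fin.Subset using (Subset; ∣_∣)
open import Data.Fin.Subset.Properties using (anySubset?)
open import Data.Vec using (Vec; []; _∷_; lookup; tabulate; _[_]≔_)
import Data.Vec as Vec
open import Data.Vec.Properties
  using (lookup∘tabulate; tabulate∘lookup; tabulate-cong; lookup∘update; lookup∘update′; ≡-dec)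
open import Data.Vec.Relation.Unary.All using (All; []; _∷_)
import Data.Vec.Relation.Unary.All as All
open import Data.Vec.Relation.Unary.AllPairs using (AllPairs; []; _∷_)
import Data.Vec.Relation.Unary.AllPairs as AllPairs
import Data.Vec.Relation.Unary.AllPairs.Properties as AllPairs
open import Data.List using (List; []; _∷_; _++_; map; foldr; length; allFin; cartesianProductWith)
open import Data.List.Properties using (length-tabulate; map-tabulate)
open import Data.List.Membership.Propositional using (_∈_)
open import Data.List.Membership.Propositional.Properties using (∈-allFin; ∈-cartesianProductWith⁺)
import Data.List.Relation.Unary.All as ListAll
import Data.List.Relation.Unary.All.Properties as ListAll
open import Data.List.Relation.Unary.Any using (here; there)
open import Data.Product using (∃; Σ; _×_; _,_; proj₁; proj₂)
open import Data.Sum using (_⊎_; inj₁; inj₂; [_,_]′; map₂)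
open import Function using (_∘_; id; Equivalence; Inverse)
open import Function.Definitions using (Injective)
open import Relation.Nullary using (¬_; Dec; yes; no; does; contradiction; _×-dec_; _→-dec_)
open import Relation.Nullary.Decidable using (⌊_⌋; dec-true)
open import Relation.Binary.PropositionalEquality
  using (_≡_; _≢_; refl; sym; trans; cong; cong₂; subst; subst₂; module ≡-Reasoning)

private
  variable
    A B : Set
    n : ℕ

-- Finite sums

⟦_⟧ : Bool → ℕ
⟦ b ⟧ = if b then 1 else 0

∑ : List A → (A → ℕ) → ℕ
∑ []       f = 0
∑ (x ∷ xs) f = f x + ∑ xs f

sum-map : (xs : List A) (f : A → ℕ) → sum (map f xs) ≡ ∑ xs f
sum-map []       f = refl
sum-map (x ∷ xs) f = cong (f x +_) (sum-map xs f)

∑-mono : (xs : List A) {f g : A → ℕ} → (∀ x → f x ≤ g x) → ∑ xs f ≤ ∑ xs g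
∑-mono []       f≤g = z≤n
∑-mono (x ∷ xs) f≤g = +-mono-≤ (f≤g x) (∑-mono xs f≤g)

∑-cong : (xs : List A) {f g : A → ℕ} → (∀ x → f x ≡ g x) → ∑ xs f ≡ ∑ xs g
∑-cong []       f≡g = refl
∑-cong (x ∷ xs) f≡g = cong₂ _+_ (f≡g x) (∑-cong xs f≡g)

∑-const : (xs : List A) (c : ℕ) → ∑ xs (λ _ → c) ≡ length xs * c
∑-const []       c = refl
∑-const (x ∷ xs) c = cong (c +_) (∑-const xs c)

∑-+ : (xs : List A) (f g : A → ℕ) → ∑ xs (λ x → f x + g x) ≡ ∑ xs f + ∑ xs g
∑-+ []       f g = refl
∑-+ (x ∷ xs) f g rewrite ∑-+ xs f g = interchange (f x) (g x) (∑ xs f) (∑ xs g)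
  where
  interchange : ∀ a b c d → a + b + (c + d) ≡ a + c + (b + d)
  interchange = solve-∀

∑-*ˡ : (xs : List A) (c : ℕ) (f : A → ℕ) → ∑ xs (λ x → c * f x) ≡ c * ∑ xs f
∑-*ˡ []       c f = sym (*-zeroʳ c)
∑-*ˡ (x ∷ xs) c f rewrite ∑-*ˡ xs c f = sym (*-distribˡ-+ c (f x) (∑ xs f))

∑-*ʳ : (xs : List A) (c : ℕ) (f : A → ℕ) → ∑ xs (λ x → f x * c) ≡ ∑ xs f * c
∑-*ʳ xs c f =
  trans (∑-cong xs (λ x → *-comm (f x) c)) (trans (∑-*ˡ xs c f) (*-comm c (∑ xs f)))

∑-comm : (xs : List A) (ys : List B) (f : A → B → ℕ) →
         ∑ xs (λ x → ∑ ys (f x)) ≡ ∑ ys (λ y → ∑ xs (λ x → f x y))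
∑-comm []       ys f = sym (trans (∑-const ys 0) (*-zeroʳ (length ys)))
∑-comm (x ∷ xs) ys f rewrite ∑-comm xs ys f = sym (∑-+ ys (f x) (λ y → ∑ xs (λ x → f x y)))

∑-× : (xs : List A) (ys : List B) (f : A → ℕ) (g : B → ℕ) →
      ∑ xs (λ x → ∑ ys (λ y → f x * g y)) ≡ ∑ xs f * ∑ ys g
∑-× xs ys f g = trans (∑-cong xs (λ x → ∑-*ˡ ys (f x) g)) (∑-*ʳ xs (∑ ys g) f)

∑∑-+ : (xs : List A) (ys : List B) (f g : A → B → ℕ) →
  ∑ xs (λ x → ∑ ys λ y → f x y + g x y) ≡ ∑ xs (λ x → ∑ ys (f x)) + ∑ xs (λ x → ∑ ys (g x))
∑∑-+ xs ys f g = trans (∑-cong xs λ x → ∑-+ ys (f x) (g x)) (∑-+ xs _ _)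

∑-∈ : {xs : List A} {x : A} (f : A → ℕ) → x ∈ xs → f x ≤ ∑ xs f
∑-∈ {xs = x ∷ xs} f (here refl) = m≤m+n (f x) (∑ xs f)
∑-∈ {xs = y ∷ xs} f (there x∈)  = ≤-trans (∑-∈ f x∈) (m≤n+m (∑ xs f) (f y))

∑-++ : (xs ys : List A) (f : A → ℕ) → ∑ (xs ++ ys) f ≡ ∑ xs f + ∑ ys f
∑-++ []       ys f = refl
∑-++ (x ∷ xs) ys f = trans (cong (f x +_) (∑-++ xs ys f)) (sym (+-assoc (f x) (∑ xs f) (∑ ys f)))

∑-map : (g : A → B) (xs : List A) (f : B → ℕ) → ∑ (map g xs) f ≡ ∑ xs (f ∘ g)
∑-map g []       f = refl
∑-map g (x ∷ xs) f = cong (f (g x) +_) (∑-map g xs f)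

∑-cartesianProductWith : {C : Set} (h : A → B → C) (xs : List A) (ys : List B) (f : C → ℕ) →
  ∑ (cartesianProductWith h xs ys) f ≡ ∑ xs (λ x → ∑ ys (λ y → f (h x y)))
∑-cartesianProductWith h []       ys f = refl
∑-cartesianProductWith h (x ∷ xs) ys f =
  trans (∑-++ (map (h x) ys) (cartesianProductWith h xs ys) f)
        (cong₂ _+_ (∑-map (h x) ys f) (∑-cartesianProductWith h xs ys f))

-- The power mean inequality.

^-distribʳ-* : ∀ k a b → (a * b) ^ k ≡ a ^ k * b ^ k
^-distribʳ-* zero    a b = refl
^-distribʳ-* (suc k) a b rewrite ^-distribʳ-* k a b = interchange a b (a ^ k) (b ^ k)
  where
  interchange : ∀ a b c d → a * b * (c * d) ≡ a * c * (b * d)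
  interchange = solve-∀

-- With `b = a + d` and `b ^ s = a ^ s + e`, the two sides differ by exactly `d * e`.
rearrangement : ∀ s a b → a ≤ b → a * b ^ s + b * a ^ s ≤ a * a ^ s + b * b ^ s
rearrangement s a b a≤b
  with d , refl ← m≤n⇒∃[o]m+o≡n a≤b
  with e , eq ← m≤n⇒∃[o]m+o≡n (^-monoˡ-≤ s a≤b) rewrite sym eq =
  ≤-trans (m≤m+n _ (d * e)) (≤-reflexive (expand a d (a ^ s) e))
  where
  expand : ∀ a d p e → a * (p + e) + (a + d) * p + d * e ≡ a * p + (a + d) * (p + e)
  expand = solve-∀

-- Sum the rearrangement inequality over all pairs.
chebyshev : (xs : List A) (f : A → ℕ) (s : ℕ) →
            ∑ xs f * ∑ xs (λ x → f x ^ s) ≤ length xs * ∑ xs (λ x → f x ^ suc s)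
chebyshev xs f s = *-cancelˡ-≤ 2 (begin
  2 * (F₁ * Fₛ)                                                        ≡⟨ double (F₁ * Fₛ) ⟩
  F₁ * Fₛ + F₁ * Fₛ                                                    ≡⟨ cong₂ _+_ pairs (trans (∑-comm xs xs _) pairs) ⟨
  ∑ xs (λ x → ∑ xs λ y → f x * f y ^ s) + ∑ xs (λ x → ∑ xs λ y → f y * f x ^ s)
                                                                       ≡⟨ ∑∑-+ xs xs (λ x y → f x * f y ^ s) (λ x y → f y * f x ^ s) ⟨
  ∑ xs (λ x → ∑ xs λ y → f x * f y ^ s + f y * f x ^ s)                ≤⟨ ∑-mono xs (λ x → ∑-mono xs λ y → swap (f x) (f y)) ⟩
  ∑ xs (λ x → ∑ xs λ y → f x ^ suc s + f y ^ suc s)                    ≡⟨ ∑∑-+ xs xs (λ x y → f x ^ suc s) (λ x y → f y ^ suc s) ⟩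
  ∑ xs (λ x → ∑ xs λ y → f x ^ suc s) + ∑ xs (λ x → ∑ xs λ y → f y ^ suc s)
                                                                       ≡⟨ cong₂ _+_ (trans (∑-comm xs xs _) (∑-const xs G)) (∑-const xs G) ⟩
  length xs * G + length xs * G                                        ≡⟨ double (length xs * G) ⟨
  2 * (length xs * G)                                                  ∎)
  where
  open ≤-Reasoning
  F₁ Fₛ G : ℕ
  F₁ = ∑ xs f
  Fₛ = ∑ xs (λ x → f x ^ s)
  G  = ∑ xs (λ x → f x ^ suc s)
  double : ∀ a → 2 * a ≡ a + a
  double = solve-∀
  pairs : ∑ xs (λ x → ∑ xs λ y → f x * f y ^ s) ≡ F₁ * Fₛ
  pairs = ∑-× xs xs f (λ y → f y ^ s)
  swap : ∀ a b → a * b ^ s + b * a ^ s ≤ a ^ suc s + b ^ suc s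
  swap a b with ≤-total a b
  ... | inj₁ a≤b = rearrangement s a b a≤b
  ... | inj₂ b≤a = begin
    a * b ^ s + b * a ^ s ≡⟨ +-comm (a * b ^ s) _ ⟩
    b * a ^ s + a * b ^ s ≤⟨ rearrangement s b a b≤a ⟩
    b ^ suc s + a ^ suc s ≡⟨ +-comm (b ^ suc s) _ ⟩
    a ^ suc s + b ^ suc s ∎

-- Induction on `s`, each step raising one exponent by `chebyshev`. Both sides carry powers of the
-- length in place of averages, so neither division nor the exponent `s - 1` occurs.
powerMean : (xs : List A) (f : A → ℕ) (s : ℕ) →
            ∑ xs f ^ s * length xs ≤ length xs ^ s * ∑ xs (λ x → f x ^ s)
powerMean xs f zero    = begin
  1 * length xs       ≡⟨ cong (1 *_) (*-identityʳ (length xs)) ⟨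
  1 * (length xs * 1) ≡⟨ cong (1 *_) (∑-const xs 1) ⟨
  1 * ∑ xs (λ _ → 1)  ∎
  where open ≤-Reasoning
powerMean xs f (suc s) = begin
  F₁ * F₁ ^ s * m             ≡⟨ *-assoc F₁ (F₁ ^ s) m ⟩
  F₁ * (F₁ ^ s * m)           ≤⟨ *-monoʳ-≤ F₁ (powerMean xs f s) ⟩
  F₁ * (m ^ s * Fₛ)           ≡⟨ shuffle F₁ (m ^ s) Fₛ ⟩
  m ^ s * (F₁ * Fₛ)           ≤⟨ *-monoʳ-≤ (m ^ s) (chebyshev xs f s) ⟩
  m ^ s * (m * G)             ≡⟨ shuffle′ (m ^ s) m G ⟩
  m ^ suc s * G               ∎
  where
  open ≤-Reasoning
  m F₁ Fₛ G : ℕ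
  m  = length xs
  F₁ = ∑ xs f
  Fₛ = ∑ xs (λ x → f x ^ s)
  G  = ∑ xs (λ x → f x ^ suc s)
  shuffle : ∀ a b c → a * (b * c) ≡ b * (a * c)
  shuffle = solve-∀
  shuffle′ : ∀ a b c → a * (b * c) ≡ b * a * c
  shuffle′ = solve-∀

-- Counting vectors of vertices.

⟦∧⟧ : ∀ a b → ⟦ a ∧ b ⟧ ≡ ⟦ a ⟧ * ⟦ b ⟧
⟦∧⟧ true  b = sym (+-identityʳ ⟦ b ⟧)
⟦∧⟧ false b = refl

⟦⟧≤1 : ∀ b → ⟦ b ⟧ ≤ 1
⟦⟧≤1 true  = ≤-refl
⟦⟧≤1 false = z≤n

length-allFin : ∀ n → length (allFin n) ≡ n
length-allFin n = length-tabulate id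

vecs : (n k : ℕ) → List (Vec (Fin n) k)
vecs n zero    = [] ∷ []
vecs n (suc k) = cartesianProductWith _∷_ (allFin n) (vecs n k)

∑-vecs : ∀ n k (f : Vec (Fin n) (suc k) → ℕ) →
         ∑ (vecs n (suc k)) f ≡ ∑ (allFin n) (λ x → ∑ (vecs n k) (λ v → f (x ∷ v)))
∑-vecs n k f = ∑-cartesianProductWith _∷_ (allFin n) (vecs n k) f

length-vecs : ∀ n k → length (vecs n k) ≡ n ^ k
length-vecs n zero    = refl
length-vecs n (suc k) = begin
  length (vecs n (suc k))                        ≡⟨ length≡∑ (vecs n (suc k)) ⟩
  ∑ (vecs n (suc k)) (λ _ → 1)                   ≡⟨ ∑-vecs n k _ ⟩
  ∑ (allFin n) (λ _ → ∑ (vecs n k) (λ _ → 1))    ≡⟨ ∑-const (allFin n) _ ⟩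
  length (allFin n) * ∑ (vecs n k) (λ _ → 1)
    ≡⟨ cong₂ _*_ (length-allFin n) (trans (sym (length≡∑ (vecs n k))) (length-vecs n k)) ⟩
  n ^ suc k                                      ∎
  where
  open ≡-Reasoning
  length≡∑ : (xs : List A) → length xs ≡ ∑ xs (λ _ → 1)
  length≡∑ xs = sym (trans (∑-const xs 1) (*-identityʳ (length xs)))

∑-allFin-const : ∀ n c → ∑ (allFin n) (λ _ → c) ≡ n * c
∑-allFin-const n c = trans (∑-const (allFin n) c) (cong (_* c) (length-allFin n))

∑-vecs-const : ∀ n k c → ∑ (vecs n k) (λ _ → c) ≡ n ^ k * c
∑-vecs-const n k c = trans (∑-const (vecs n k) c) (cong (_* c) (length-vecs n k))

allᵇ : ∀ {k} → (A → Bool) → Vec A k → Bool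
allᵇ h []      = true
allᵇ h (x ∷ v) = h x ∧ allᵇ h v

-- Expanding the power chooses `s` elements independently. This turns powers of degrees into counts
-- of tuples `X` inside a neighbourhood.
∑^ : (h : Fin n → Bool) (s : ℕ) →
     ∑ (allFin n) (λ x → ⟦ h x ⟧) ^ s ≡ ∑ (vecs n s) (λ X → ⟦ allᵇ h X ⟧)
∑^ h zero        = refl
∑^ {n} h (suc s) = begin
  d * d ^ s                                                    ≡⟨ cong (d *_) (∑^ h s) ⟩
  d * ∑ (vecs n s) (λ X → ⟦ allᵇ h X ⟧)                        ≡⟨ ∑-× (allFin n) (vecs n s) (⟦_⟧ ∘ h) (⟦_⟧ ∘ allᵇ h) ⟨
  ∑ (allFin n) (λ x → ∑ (vecs n s) λ X → ⟦ h x ⟧ * ⟦ allᵇ h X ⟧)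
    ≡⟨ ∑-cong (allFin n) (λ x → ∑-cong (vecs n s) λ X → ⟦∧⟧ (h x) (allᵇ h X)) ⟨
  ∑ (allFin n) (λ x → ∑ (vecs n s) λ X → ⟦ h x ∧ allᵇ h X ⟧)   ≡⟨ ∑-vecs n s _ ⟨
  ∑ (vecs n (suc s)) (λ X → ⟦ allᵇ h X ⟧)                      ∎
  where
  open ≡-Reasoning
  d = ∑ (allFin n) (λ x → ⟦ h x ⟧)

-- Blow-ups in sets of tuples

count : ∀ {k} → (Vec (Fin n) k → Bool) → ℕ
count {n} {k} H = ∑ (vecs n k) (λ v → ⟦ H v ⟧)

-- These are Σ and P of the outline: the last of the `suc r` sizes is left out, since the last part
-- of a `box` is a single vertex.
sizeSum sizeProd : ∀ r → (Fin (suc r) → ℕ) → ℕ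
sizeSum zero    s = 0
sizeSum (suc r) s = s zero + sizeSum r (s ∘ suc)
sizeProd zero    s = 1
sizeProd (suc r) s = s zero * sizeProd r (s ∘ suc)

-- The intersection of the links of all entries of `X`. For the empty `X` it consists of all tuples.
link : ∀ {r k} → (Vec (Fin n) (suc r) → Bool) → Vec (Fin n) k → Vec (Fin n) r → Bool
link H X v = allᵇ (λ x → H (x ∷ v)) X

-- The number of homomorphic copies in H of the complete (r+1)-partite hypergraph with parts of
-- sizes s₀, …, s_{r-1}, 1; the vertices of a part are allowed to coincide.
box : ∀ r → (Fin (suc r) → ℕ) → (Vec (Fin n) (suc r) → Bool) → ℕ
box zero        s H = count H
box {n} (suc r) s H = ∑ (vecs n (s zero)) (λ X → box r (s ∘ suc) (link H X))

-- Double counting of the pairs `(X, v)` with `v` in the link of `X`: a fixed `v` lies in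
-- `deg v ^ k` of them, and the degrees add up to `count H`, so the power mean inequality applies.
count-link : ∀ r k (H : Vec (Fin n) (suc r) → Bool) →
  count H ^ k * n ^ r ≤ (n ^ r) ^ k * ∑ (vecs n k) (λ X → count (link H X))
count-link {n} r k H = begin
  count H ^ k * n ^ r                                ≡⟨ cong₂ (λ a b → a ^ k * b) fubini (sym (length-vecs n r)) ⟩
  ∑ (vecs n r) deg ^ k * length (vecs n r)           ≤⟨ powerMean (vecs n r) deg k ⟩
  length (vecs n r) ^ k * ∑ (vecs n r) (λ v → deg v ^ k)
    ≡⟨ cong₂ (λ a b → a ^ k * b) (length-vecs n r)
         (trans (∑-cong (vecs n r) (λ v → ∑^ (λ x → H (x ∷ v)) k)) (∑-comm (vecs n r) (vecs n k) _)) ⟩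
  (n ^ r) ^ k * ∑ (vecs n k) (λ X → count (link H X)) ∎
  where
  open ≤-Reasoning
  deg : Vec (Fin n) r → ℕ
  deg v = ∑ (allFin n) (λ x → ⟦ H (x ∷ v) ⟧)
  fubini : count H ≡ ∑ (vecs n r) deg
  fubini = trans (∑-vecs n r _) (∑-comm (allFin n) (vecs n r) _)

-- Induction on the number of coordinates. `count-link` handles the first one; its `p`-th power is
-- carried inside the sum over `X` by a second power mean, and the induction hypothesis bounds each
-- link.
box-lower : ∀ {n} .{{_ : NonZero n}} r s (H : Vec (Fin n) (suc r) → Bool) →
  count H ^ sizeProd r s * n ^ suc (sizeSum r s) ≤ n ^ (suc r * sizeProd r s) * box r s H
box-lower {n} zero    s H = ≤-reflexive (lemma (count H) n)
  where
  lemma : ∀ c n → c * 1 * (n * 1) ≡ n * 1 * c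
  lemma = solve-∀
-- The extra factor `m ^ p` is the one that `count-link` has on its smaller side, raised to the
-- power `p`.
box-lower {n} (suc r) s H = *-cancelˡ-≤ (m ^ p) (begin
  m ^ p * (count H ^ (k * p) * n ^ suc (k + σ))      ≡⟨ cong₂ (λ a b → m ^ p * (a * b)) (sym (^-*-assoc (count H) k p)) (^-distribˡ-+-* n (suc k) σ) ⟩
  m ^ p * ((count H ^ k) ^ p * (n ^ suc k * n ^ σ))  ≡⟨ arrange₁ (m ^ p) ((count H ^ k) ^ p) n (n ^ k) (n ^ σ) ⟩
  (count H ^ k) ^ p * m ^ p * (n ^ k * n ^ suc σ)    ≡⟨ cong (_* (n ^ k * n ^ suc σ)) (^-distribʳ-* p (count H ^ k) m) ⟨
  (count H ^ k * m) ^ p * (n ^ k * n ^ suc σ)        ≤⟨ *-monoˡ-≤ _ (^-monoˡ-≤ p (count-link (suc r) k H)) ⟩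
  (m ^ k * Q) ^ p * (n ^ k * n ^ suc σ)              ≡⟨ cong (_* (n ^ k * n ^ suc σ)) (^-distribʳ-* p (m ^ k) Q) ⟩
  (m ^ k) ^ p * Q ^ p * (n ^ k * n ^ suc σ)          ≡⟨ arrange₂ ((m ^ k) ^ p) (Q ^ p) (n ^ k) (n ^ suc σ) ⟩
  (m ^ k) ^ p * (Q ^ p * n ^ k * n ^ suc σ)          ≤⟨ *-monoʳ-≤ ((m ^ k) ^ p) Q^p ⟩
  (m ^ k) ^ p * ((n ^ k) ^ p * (m ^ p * β))          ≡⟨ cong₂ (λ a b → a * (b * (m ^ p * β))) mkp (^-*-assoc n k p) ⟩
  n ^ (suc r * (k * p)) * (n ^ (k * p) * (m ^ p * β)) ≡⟨ arrange₃ (n ^ (suc r * (k * p))) (n ^ (k * p)) (m ^ p) β ⟩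
  m ^ p * (n ^ (k * p) * n ^ (suc r * (k * p)) * β)  ≡⟨ cong (λ a → m ^ p * (a * β)) (^-distribˡ-+-* n (k * p) (suc r * (k * p))) ⟨
  m ^ p * (n ^ (suc (suc r) * (k * p)) * β)          ∎)
  where
  open ≤-Reasoning
  k p σ m Q β : ℕ
  k = s zero
  p = sizeProd r (s ∘ suc)
  σ = sizeSum r (s ∘ suc)
  m = n ^ suc r
  Q = ∑ (vecs n k) (λ X → count (link H X))
  β = box (suc r) s H
  instance
    m^p≢0 : NonZero (m ^ p)
    m^p≢0 = m^n≢0 m p {{m^n≢0 n (suc r)}}
  mkp : (m ^ k) ^ p ≡ n ^ (suc r * (k * p))
  mkp = trans (^-*-assoc m k p) (^-*-assoc n (suc r) (k * p))
  mp : m ^ p ≡ n ^ (suc r * p)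
  mp = ^-*-assoc n (suc r) p
  Q^p : Q ^ p * n ^ k * n ^ suc σ ≤ (n ^ k) ^ p * (m ^ p * β)
  Q^p = begin
    Q ^ p * n ^ k * n ^ suc σ ≡⟨ cong (λ a → Q ^ p * a * n ^ suc σ) (length-vecs n k) ⟨
    Q ^ p * length (vecs n k) * n ^ suc σ
      ≤⟨ *-monoˡ-≤ (n ^ suc σ) (powerMean (vecs n k) (λ X → count (link H X)) p) ⟩
    length (vecs n k) ^ p * ∑ (vecs n k) (λ X → count (link H X) ^ p) * n ^ suc σ
      ≡⟨ cong (λ a → a ^ p * ∑ (vecs n k) (λ X → count (link H X) ^ p) * n ^ suc σ) (length-vecs n k) ⟩
    (n ^ k) ^ p * ∑ (vecs n k) (λ X → count (link H X) ^ p) * n ^ suc σ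
      ≡⟨ trans (*-assoc ((n ^ k) ^ p) _ _) (cong ((n ^ k) ^ p *_) (sym (∑-*ʳ (vecs n k) (n ^ suc σ) _))) ⟩
    (n ^ k) ^ p * ∑ (vecs n k) (λ X → count (link H X) ^ p * n ^ suc σ)
      ≤⟨ *-monoʳ-≤ ((n ^ k) ^ p) (∑-mono (vecs n k) λ X → box-lower r (s ∘ suc) (link H X)) ⟩
    (n ^ k) ^ p * ∑ (vecs n k) (λ X → n ^ (suc r * p) * box r (s ∘ suc) (link H X))
      ≡⟨ cong ((n ^ k) ^ p *_) (trans (∑-*ˡ (vecs n k) (n ^ (suc r * p)) _) (cong (_* β) (sym mp))) ⟩
    (n ^ k) ^ p * (m ^ p * β) ∎
  arrange₁ : ∀ a b n c d → a * (b * (n * c * d)) ≡ b * a * (c * (n * d))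
  arrange₁ = solve-∀
  arrange₂ : ∀ a b c d → a * b * (c * d) ≡ a * (b * c * d)
  arrange₂ = solve-∀
  arrange₃ : ∀ a b c d → a * (b * (c * d)) ≡ c * (b * a * d)
  arrange₃ = solve-∀

∑-allFin-suc : ∀ n (f : Fin (suc n) → ℕ) → ∑ (allFin (suc n)) f ≡ f zero + ∑ (allFin n) (f ∘ suc)
∑-allFin-suc n f = cong (f zero +_)
  (trans (cong (λ xs → ∑ xs f) (sym (map-tabulate id suc))) (∑-map suc (allFin n) f))

∑-δ : (p : Fin n) (f : Fin n → ℕ) → ∑ (allFin n) (λ a → ⟦ does (p F.≟ a) ⟧ * f a) ≡ f p
∑-δ {suc n} zero    f = begin
  ∑ (allFin (suc n)) (λ a → ⟦ does (zero F.≟ a) ⟧ * f a) ≡⟨ ∑-allFin-suc n _ ⟩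
  f zero + 0 + ∑ (allFin n) (λ _ → 0) ≡⟨ cong₂ _+_ (+-identityʳ (f zero)) (∑-const (allFin n) 0) ⟩
  f zero + length (allFin n) * 0      ≡⟨ cong (f zero +_) (*-zeroʳ (length (allFin n))) ⟩
  f zero + 0                          ≡⟨ +-identityʳ (f zero) ⟩
  f zero                              ∎
  where open ≡-Reasoning
∑-δ {suc n} (suc p) f = trans (∑-allFin-suc n (λ a → ⟦ does (suc p F.≟ a) ⟧ * f a)) (∑-δ p (f ∘ suc))

-- A greedy scan from the smallest vertex on; the choice is increasing, hence injective.
select : ∀ n (h : Fin n → Bool) t → t ≤ ∑ (allFin n) (⟦_⟧ ∘ h) →
         Σ (Fin t → Fin n) λ g → Injective _≡_ _≡_ g × (∀ i → T (h (g i)))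
select n h zero    _   = (λ ()) , (λ { {()} }) , λ ()
select zero h (suc t) ()
select (suc n) h (suc t) t≤ rewrite ∑-allFin-suc n (⟦_⟧ ∘ h) with h zero in h₀
... | true with g , inj , hg ← select n (h ∘ suc) t (≤-pred t≤) = g′ , inj′ , hg′
  where
  g′ : Fin (suc t) → Fin (suc n)
  g′ zero    = zero
  g′ (suc i) = suc (g i)
  inj′ : Injective _≡_ _≡_ g′
  inj′ {zero}  {zero}  _  = refl
  inj′ {suc i} {suc j} eq = cong suc (inj (F.suc-injective eq))
  hg′ : ∀ i → T (h (g′ i))
  hg′ zero    = subst T (sym h₀) _
  hg′ (suc i) = hg i
... | false with g , inj , hg ← select n (h ∘ suc) (suc t) t≤ =
  suc ∘ g , inj ∘ F.suc-injective , hg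

-- Tuples with repeated entries.

infix 7 _∈ᵇ_
_∈ᵇ_ : ∀ {k} → Fin n → Vec (Fin n) k → Bool
x ∈ᵇ []      = false
x ∈ᵇ (y ∷ v) = does (x F.≟ y) ∨ x ∈ᵇ v

repeats : ∀ {k} → Vec (Fin n) k → Bool
repeats []      = false
repeats (x ∷ v) = x ∈ᵇ v ∨ repeats v

∈ᵇ-lookup : ∀ {k} (v : Vec (Fin n) k) j → (lookup v j ∈ᵇ v) ≡ true
∈ᵇ-lookup (y ∷ v) zero with y F.≟ y
... | yes _  = refl
... | no y≢y = contradiction refl y≢y
∈ᵇ-lookup (y ∷ v) (suc j) with does (lookup v j F.≟ y)
... | true  = refl
... | false = ∈ᵇ-lookup v j

lookup-injective : ∀ {k} (v : Vec (Fin n) k) → repeats v ≡ false → Injective _≡_ _≡_ (lookup v)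
lookup-injective (x ∷ v) rep {zero}  {zero}  eq = refl
lookup-injective (x ∷ v) rep {zero}  {suc j} refl with () ← trans (sym rep) (cong (_∨ repeats v) (∈ᵇ-lookup v j))
lookup-injective (x ∷ v) rep {suc i} {zero}  refl with () ← trans (sym rep) (cong (_∨ repeats v) (∈ᵇ-lookup v i))
lookup-injective (x ∷ v) rep {suc i} {suc j} eq with x ∈ᵇ v
... | false = cong suc (lookup-injective v rep eq)

⟦∨⟧ : ∀ a b → ⟦ a ∨ b ⟧ ≤ ⟦ a ⟧ + ⟦ b ⟧
⟦∨⟧ true  b = s≤s z≤n
⟦∨⟧ false b = ≤-refl

-- Union bound over the `k` positions that `x` may occupy. The factor `n` on the left avoids the
-- exponent `k - 1`.
count-∈ᵇ : ∀ k (x : Fin n) → count {k = k} (x ∈ᵇ_) * n ≤ k * n ^ k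
count-∈ᵇ zero    x = z≤n
count-∈ᵇ {n} (suc k) x = begin
  count {k = suc k} (x ∈ᵇ_) * n
    ≡⟨ cong (_* n) (∑-vecs n k _) ⟩
  ∑ (allFin n) (λ y → ∑ (vecs n k) λ v → ⟦ does (x F.≟ y) ∨ x ∈ᵇ v ⟧) * n
    ≤⟨ *-monoˡ-≤ n (∑-mono (allFin n) λ y → ∑-mono (vecs n k) λ v → ⟦∨⟧ (does (x F.≟ y)) (x ∈ᵇ v)) ⟩
  ∑ (allFin n) (λ y → ∑ (vecs n k) λ v → ⟦ does (x F.≟ y) ⟧ + ⟦ x ∈ᵇ v ⟧) * n
    ≡⟨ cong (_* n) (trans (∑-cong (allFin n) λ y →
         trans (∑-+ (vecs n k) _ _) (cong (_+ M) (trans (∑-vecs-const n k _) (*-comm (n ^ k) _))))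
         (∑-+ (allFin n) _ _)) ⟩
  (∑ (allFin n) (λ y → ⟦ does (x F.≟ y) ⟧ * n ^ k) + ∑ (allFin n) (λ _ → M)) * n
    ≡⟨ cong (_* n) (cong₂ _+_ (∑-δ x (λ _ → n ^ k)) (∑-allFin-const n M)) ⟩
  (n ^ k + n * M) * n
    ≡⟨ arrange (n ^ k) n M ⟩
  n * n ^ k + n * (M * n)
    ≤⟨ +-monoʳ-≤ (n * n ^ k) (*-monoʳ-≤ n (count-∈ᵇ k x)) ⟩
  n * n ^ k + n * (k * n ^ k)
    ≡⟨ arrange′ n (n ^ k) k ⟩
  suc k * n ^ suc k ∎
  where
  open ≤-Reasoning
  M : ℕ
  M = count {k = k} (x ∈ᵇ_)
  arrange : ∀ a n m → (a + n * m) * n ≡ n * a + n * (m * n)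
  arrange = solve-∀
  arrange′ : ∀ n a k → n * a + n * (k * a) ≡ suc k * (n * a)
  arrange′ = solve-∀

-- The binomial coefficient `k` choose 2: the number of pairs of positions at which a tuple can
-- repeat itself.
triangular : ℕ → ℕ
triangular zero    = 0
triangular (suc k) = k + triangular k

-- Union bound over pairs of positions. The companion with a prescribed first entry drives the
-- induction and is needed again when the heads of two tuples are fixed.
count-repeats : ∀ n k → count {n} {k} repeats * n ≤ triangular k * n ^ k
count-repeats-∷ : ∀ k (x : Fin n) →
  count {k = k} (λ v → repeats (x ∷ v)) * n ≤ triangular (suc k) * n ^ k

count-repeats n zero    = z≤n
count-repeats n (suc k) = begin
  count {n} {suc k} repeats * n
    ≡⟨ cong (_* n) (∑-vecs n k _) ⟩
  ∑ (allFin n) (λ x → count {k = k} (λ v → repeats (x ∷ v))) * n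
    ≡⟨ ∑-*ʳ (allFin n) n _ ⟨
  ∑ (allFin n) (λ x → count {k = k} (λ v → repeats (x ∷ v)) * n)
    ≤⟨ ∑-mono (allFin n) (count-repeats-∷ k) ⟩
  ∑ (allFin n) (λ _ → triangular (suc k) * n ^ k)
    ≡⟨ ∑-allFin-const n _ ⟩
  n * (triangular (suc k) * n ^ k)
    ≡⟨ arrange n (triangular (suc k)) (n ^ k) ⟩
  triangular (suc k) * n ^ suc k ∎
  where
  open ≤-Reasoning
  arrange : ∀ a b c → a * (b * c) ≡ b * (a * c)
  arrange = solve-∀

count-repeats-∷ {n} k x = begin
  count {k = k} (λ v → repeats (x ∷ v)) * n
    ≤⟨ *-monoˡ-≤ n (∑-mono (vecs n k) λ v → ⟦∨⟧ (x ∈ᵇ v) (repeats v)) ⟩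
  ∑ (vecs n k) (λ v → ⟦ x ∈ᵇ v ⟧ + ⟦ repeats v ⟧) * n
    ≡⟨ trans (cong (_* n) (∑-+ (vecs n k) _ _)) (*-distribʳ-+ n (count {k = k} (x ∈ᵇ_)) _) ⟩
  count {k = k} (x ∈ᵇ_) * n + count {n} {k} repeats * n
    ≤⟨ +-mono-≤ (count-∈ᵇ k x) (count-repeats n k) ⟩
  k * n ^ k + triangular k * n ^ k
    ≡⟨ *-distribʳ-+ (n ^ k) k (triangular k) ⟨
  triangular (suc k) * n ^ k ∎
  where open ≤-Reasoning

-- Injectivity is required only within each part. When `H` consists of cliques, different parts are
-- disjoint automatically, because adjacent vertices are distinct.
record Blowup {n} r (s : Fin (suc r) → ℕ) (H : Vec (Fin n) (suc r) → Bool) : Set where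
  field
    part      : ∀ i → Fin (s i) → Fin n
    injective : ∀ i → Injective _≡_ _≡_ (part i)
    complete  : (c : ∀ i → Fin (s i)) → T (H (tabulate λ i → part i (c i)))
open Blowup

T-allᵇ : ∀ {k} (h : A → Bool) (X : Vec A k) → T (allᵇ h X) → ∀ j → T (h (lookup X j))
T-allᵇ h (x ∷ X) t zero with h x
... | true = _
T-allᵇ h (x ∷ X) t (suc j) with h x
... | true = T-allᵇ h X t j

extend : ∀ {r s} {H : Vec (Fin n) (suc (suc r)) → Bool} (X : Vec (Fin n) (s zero)) →
         repeats X ≡ false → Blowup r (s ∘ suc) (link H X) → Blowup (suc r) s H
extend X rep b .part zero    = lookup X
extend X rep b .part (suc i) = part b i
extend X rep b .injective zero    = lookup-injective X rep
extend X rep b .injective (suc i) = injective b i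
extend {H = H} X rep b .complete c =
  T-allᵇ (λ x → H (x ∷ tabulate λ i → part b i (c (suc i)))) X (complete b (c ∘ suc)) (c zero)

count≤ : ∀ {k} (H : Vec (Fin n) k → Bool) → count H ≤ n ^ k
count≤ {n} {k} H = begin
  count H                ≤⟨ ∑-mono (vecs n k) (λ v → ⟦⟧≤1 (H v)) ⟩
  ∑ (vecs n k) (λ _ → 1) ≡⟨ ∑-vecs-const n k 1 ⟩
  n ^ k * 1              ≡⟨ *-identityʳ (n ^ k) ⟩
  n ^ k                  ∎
  where open ≤-Reasoning

box≤ : ∀ r s (H : Vec (Fin n) (suc r) → Bool) → box r s H ≤ n ^ suc (sizeSum r s)
box≤ zero    s H = count≤ H
box≤ {n} (suc r) s H = begin
  ∑ (vecs n k) (λ X → box r (s ∘ suc) (link H X)) ≤⟨ ∑-mono (vecs n k) (λ X → box≤ r (s ∘ suc) (link H X)) ⟩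
  ∑ (vecs n k) (λ _ → n ^ suc σ)                  ≡⟨ ∑-vecs-const n k _ ⟩
  n ^ k * n ^ suc σ                               ≡⟨ ^-distribˡ-+-* n k (suc σ) ⟨
  n ^ (k + suc σ)                                 ≡⟨ cong (n ^_) (+-suc k σ) ⟩
  n ^ suc (k + σ)                                 ∎
  where
  open ≤-Reasoning
  k σ : ℕ
  k = s zero
  σ = sizeSum r (s ∘ suc)

allᵇ-false : ∀ {k} {h : A → Bool} → (∀ x → h x ≡ false) → 1 ≤ k → (X : Vec A k) → allᵇ h X ≡ false
allᵇ-false {h = h} h≡f 1≤k (x ∷ X) = cong (_∧ allᵇ h X) (h≡f x)

-- Positive sizes matter here: the link of an empty tuple is full even if `H` is empty.
box-false : ∀ r s → (∀ i → 1 ≤ s i) → (H : Vec (Fin n) (suc r) → Bool) → (∀ v → H v ≡ false) → box r s H ≡ 0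
box-false {n} zero    s 1≤s H H≡f =
  trans (∑-cong (vecs n 1) (λ v → cong ⟦_⟧ (H≡f v))) (trans (∑-vecs-const n 1 0) (*-zeroʳ (n ^ 1)))
box-false {n} (suc r) s 1≤s H H≡f =
  trans (∑-cong (vecs n (s zero)) λ X → box-false r (s ∘ suc) (1≤s ∘ suc) (link H X)
           (λ v → allᵇ-false (λ x → H≡f (x ∷ v)) (1≤s zero) X))
        (trans (∑-vecs-const n (s zero) 0) (*-zeroʳ (n ^ s zero)))

-- The last size plus the sum of `s i` choose 2 over the other parts: the constant in the O(n^Σ)
-- bound.
boxConst : ∀ r → (Fin (suc r) → ℕ) → ℕ
boxConst zero    s = s zero
boxConst (suc r) s = triangular (s zero) + boxConst r (s ∘ suc)

-- Peel off the first part. A choice `X` with repetitions is given the trivial bound `box≤`,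
-- affordable because such `X` are rarer by a factor O(1/n). For the other `X` a blow-up in the link
-- would extend to one in `H`, so induction applies. At the end fewer than `s zero` vertices remain.
box-upper : ∀ r s (H : Vec (Fin n) (suc r) → Bool) → ¬ Blowup r s H →
            box r s H ≤ boxConst r s * n ^ sizeSum r s
box-upper {n} zero s H ¬b with s zero ≤? ∑ (allFin n) (λ x → ⟦ H (x ∷ []) ⟧)
... | yes t≤ with g , inj , hg ← select n (λ x → H (x ∷ [])) (s zero) t≤ =
  contradiction single ¬b
  where
  single : Blowup zero s H
  single .part zero      = g
  single .injective zero = inj
  single .complete c     = hg (c zero)
... | no t≰ = begin
  count H                                ≡⟨ ∑-vecs n 0 _ ⟩
  ∑ (allFin n) (λ x → ⟦ H (x ∷ []) ⟧ + 0) ≡⟨ ∑-cong (allFin n) (λ x → +-identityʳ _) ⟩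
  ∑ (allFin n) (λ x → ⟦ H (x ∷ []) ⟧)    ≤⟨ <⇒≤ (≰⇒> t≰) ⟩
  s zero                                 ≡⟨ *-identityʳ (s zero) ⟨
  s zero * 1                             ∎
  where open ≤-Reasoning
box-upper {n} (suc r) s H ¬b = begin
  ∑ (vecs n k) (λ X → box r (s ∘ suc) (link H X))
    ≤⟨ ∑-mono (vecs n k) bound ⟩
  ∑ (vecs n k) (λ X → ⟦ repeats X ⟧ * (n * n ^ σ) + κ * n ^ σ)
    ≡⟨ trans (∑-+ (vecs n k) _ _) (cong₂ _+_ (∑-*ʳ (vecs n k) (n * n ^ σ) _) (∑-vecs-const n k _)) ⟩
  count {n} {k} repeats * (n * n ^ σ) + n ^ k * (κ * n ^ σ)
    ≡⟨ cong (_+ n ^ k * (κ * n ^ σ)) (*-assoc (count {n} {k} repeats) n (n ^ σ)) ⟨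
  count {n} {k} repeats * n * n ^ σ + n ^ k * (κ * n ^ σ)
    ≤⟨ +-monoˡ-≤ _ (*-monoˡ-≤ (n ^ σ) (count-repeats n k)) ⟩
  triangular k * n ^ k * n ^ σ + n ^ k * (κ * n ^ σ)
    ≡⟨ arrange (triangular k) (n ^ k) (n ^ σ) κ ⟩
  (triangular k + κ) * (n ^ k * n ^ σ)
    ≡⟨ cong ((triangular k + κ) *_) (^-distribˡ-+-* n k σ) ⟨
  (triangular k + κ) * n ^ (k + σ) ∎
  where
  open ≤-Reasoning
  k σ κ : ℕ
  k = s zero
  σ = sizeSum r (s ∘ suc)
  κ = boxConst r (s ∘ suc)
  bound : ∀ X → box r (s ∘ suc) (link H X) ≤ ⟦ repeats X ⟧ * (n * n ^ σ) + κ * n ^ σ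
  bound X with repeats X in rep
  ... | true  = ≤-trans (box≤ r (s ∘ suc) (link H X))
                        (≤-trans (≤-reflexive (sym (+-identityʳ _))) (m≤m+n _ (κ * n ^ σ)))
  ... | false = box-upper r (s ∘ suc) (link H X) (¬b ∘ extend X rep)
  arrange : ∀ a b c d → a * b * c + b * (d * c) ≡ (a + d) * (b * c)
  arrange = solve-∀

-- The gain from confining the first two coordinates.

pairs : (Fin n → Fin n → Bool) → ℕ
pairs {n} E = ∑ (allFin n) λ x → ∑ (allFin n) λ y → ⟦ E x y ⟧

-- Fix the heads `x` and `y` and sum over the tails only. With its head prescribed, a tuple still
-- has repetitions in only an O(1/n) proportion of cases, so every pair of `E` contributes O(n^k n^l
-- N).
∑-heads : ∀ (E : Fin n → Fin n → Bool) N κ k l (b : Vec (Fin n) (suc k) → Vec (Fin n) (suc l) → ℕ) →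
  (∀ x X y Y → b (x ∷ X) (y ∷ Y) ≤
     ⟦ E x y ⟧ * (⟦ repeats (x ∷ X) ⟧ * (n * N) + ⟦ repeats (y ∷ Y) ⟧ * (n * N) + κ * N)) →
  ∑ (vecs n (suc k)) (λ X → ∑ (vecs n (suc l)) (b X)) ≤
    pairs E * ((triangular (suc k) + (triangular (suc l) + κ)) * (n ^ k * (n ^ l * N)))
∑-heads {n} E N κ k l b b≤ = begin
  ∑ (vecs n (suc k)) (λ X → ∑ (vecs n (suc l)) (b X))
    ≡⟨ trans (∑-vecs n k _) (∑-cong (allFin n) λ x →
         trans (∑-cong (vecs n k) λ X → ∑-vecs n l _) (∑-comm (vecs n k) (allFin n) _)) ⟩
  ∑ (allFin n) (λ x → ∑ (allFin n) λ y → ∑ (vecs n k) λ X → ∑ (vecs n l) λ Y → b (x ∷ X) (y ∷ Y))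
    ≤⟨ ∑-mono (allFin n) (λ x → ∑-mono (allFin n) λ y → tails x y) ⟩
  ∑ (allFin n) (λ x → ∑ (allFin n) λ y → ⟦ E x y ⟧ * W)
    ≡⟨ trans (∑-cong (allFin n) λ x → ∑-*ʳ (allFin n) W _) (∑-*ʳ (allFin n) W _) ⟩
  pairs E * W ∎
  where
  open ≤-Reasoning
  W : ℕ
  W = (triangular (suc k) + (triangular (suc l) + κ)) * (n ^ k * (n ^ l * N))
  ∑∑-*ˡ : ∀ c (f : Vec (Fin n) k → Vec (Fin n) l → ℕ) →
    ∑ (vecs n k) (λ X → ∑ (vecs n l) λ Y → c * f X Y) ≡ c * ∑ (vecs n k) (λ X → ∑ (vecs n l) (f X))
  ∑∑-*ˡ c f = trans (∑-cong (vecs n k) λ X → ∑-*ˡ (vecs n l) c (f X)) (∑-*ˡ (vecs n k) c _)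
  arrange : ∀ u v κ p q n N →
    p * (q * (κ * N)) + (u * (n * N) * q + p * (v * (n * N))) ≡ κ * (p * (q * N)) + (u * n * (q * N) + v * n * (p * N))
  arrange = solve-∀
  arrange′ : ∀ a b κ p q N →
    κ * (p * (q * N)) + (a * p * (q * N) + b * q * (p * N)) ≡ (a + (b + κ)) * (p * (q * N))
  arrange′ = solve-∀
  tails : ∀ x y → ∑ (vecs n k) (λ X → ∑ (vecs n l) λ Y → b (x ∷ X) (y ∷ Y)) ≤ ⟦ E x y ⟧ * W
  tails x y = begin
    ∑ (vecs n k) (λ X → ∑ (vecs n l) λ Y → b (x ∷ X) (y ∷ Y))
      ≤⟨ ∑-mono (vecs n k) (λ X → ∑-mono (vecs n l) λ Y →
           ≤-trans (b≤ x X y Y) (≤-reflexive (cong (⟦ E x y ⟧ *_) (+-comm _ (κ * N))))) ⟩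
    ∑ (vecs n k) (λ X → ∑ (vecs n l) λ Y →
      ⟦ E x y ⟧ * (κ * N + (⟦ repeats (x ∷ X) ⟧ * (n * N) + ⟦ repeats (y ∷ Y) ⟧ * (n * N))))
      ≡⟨ trans (∑∑-*ˡ ⟦ E x y ⟧ _) (cong (⟦ E x y ⟧ *_) (trans (∑∑-+ (vecs n k) (vecs n l) _ _) (cong₂ _+_
           (trans (∑-cong (vecs n k) λ X → ∑-vecs-const n l _) (∑-vecs-const n k _))
           (trans (∑∑-+ (vecs n k) (vecs n l) _ _) (cong₂ _+_
             (trans (∑-cong (vecs n k) λ X → trans (∑-vecs-const n l _) (*-comm (n ^ l) _))
               (trans (∑-*ʳ (vecs n k) (n ^ l) _) (cong (_* n ^ l) (∑-*ʳ (vecs n k) (n * N) _))))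
             (trans (∑-vecs-const n k _) (cong (n ^ k *_) (∑-*ʳ (vecs n l) (n * N) _)))))))) ⟩
    ⟦ E x y ⟧ * (n ^ k * (n ^ l * (κ * N)) + (u * (n * N) * n ^ l + n ^ k * (v * (n * N))))
      ≡⟨ cong (⟦ E x y ⟧ *_) (arrange u v κ (n ^ k) (n ^ l) n N) ⟩
    ⟦ E x y ⟧ * (κ * (n ^ k * (n ^ l * N)) + (u * n * (n ^ l * N) + v * n * (n ^ k * N)))
      ≤⟨ *-monoʳ-≤ ⟦ E x y ⟧ (+-monoʳ-≤ (κ * (n ^ k * (n ^ l * N)))
           (+-mono-≤ (*-monoˡ-≤ (n ^ l * N) (count-repeats-∷ k x)) (*-monoˡ-≤ (n ^ k * N) (count-repeats-∷ l y)))) ⟩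
    ⟦ E x y ⟧ * (κ * (n ^ k * (n ^ l * N)) + (triangular (suc k) * n ^ k * (n ^ l * N) + triangular (suc l) * n ^ l * (n ^ k * N)))
      ≡⟨ cong (⟦ E x y ⟧ *_) (arrange′ (triangular (suc k)) (triangular (suc l)) κ (n ^ k) (n ^ l) N) ⟩
    ⟦ E x y ⟧ * W ∎
    where
    u v : ℕ
    u = count {k = k} (λ X → repeats (x ∷ X))
    v = count {k = l} (λ Y → repeats (y ∷ Y))

-- As in `box-upper`, but with the first two parts peeled off together: the double link of `X` and
-- `Y` is empty unless their heads form a pair of `E`. This gains the proportion of `E` among all n²
-- pairs.
box-upper-pairs : ∀ {r s} → (∀ i → 1 ≤ s i) →
  (H : Vec (Fin n) (suc (suc (suc r))) → Bool) → ¬ Blowup (suc (suc r)) s H →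
  (E : Fin n → Fin n → Bool) → (∀ x y v → E x y ≡ false → H (x ∷ y ∷ v) ≡ false) →
  n * n * box (suc (suc r)) s H ≤ pairs E * (boxConst (suc (suc r)) s * n ^ sizeSum (suc (suc r)) s)
box-upper-pairs {n} {r} {s} 1≤s H ¬b E E-false =
  go (s zero) (s (suc zero)) (1≤s zero) (1≤s (suc zero)) (λ X Y → box r s″ (link (link H X) Y)) bound
  where
  s″ : Fin (suc r) → ℕ
  s″ i = s (suc (suc i))
  σ κ : ℕ
  σ = sizeSum r s″
  κ = boxConst r s″
  -- The lengths `s zero` and `s (suc zero)` are not successors by definition, so the heads are read
  -- off by a total function. The default 0 belongs to empty tuples, which positive sizes exclude.
  head² : ∀ {k l} → (Fin n → Fin n → ℕ) → Vec (Fin n) k → Vec (Fin n) l → ℕ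
  head² f (x ∷ _) (y ∷ _) = f x y
  head² f _       _       = 0
  Bound : ∀ {k l} → ℕ → Vec (Fin n) k → Vec (Fin n) l → Set
  Bound b X Y = b ≤ head² (λ x y → ⟦ E x y ⟧) X Y
                    * (⟦ repeats X ⟧ * (n * n ^ σ) + ⟦ repeats Y ⟧ * (n * n ^ σ) + κ * n ^ σ)
  bound′ : ∀ X Y → box r s″ (link (link H X) Y) ≤
           ⟦ repeats X ⟧ * (n * n ^ σ) + ⟦ repeats Y ⟧ * (n * n ^ σ) + κ * n ^ σ
  bound′ X Y with repeats X in repX
  ... | true = ≤-trans (box≤ r s″ _) (≤-trans (≤-reflexive (sym (+-identityʳ _)))
                 (≤-trans (m≤m+n _ (⟦ repeats Y ⟧ * (n * n ^ σ))) (m≤m+n _ (κ * n ^ σ))))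
  ... | false with repeats Y in repY
  ...   | true  = ≤-trans (box≤ r s″ _) (≤-trans (≤-reflexive (sym (+-identityʳ _))) (m≤m+n _ (κ * n ^ σ)))
  ...   | false = box-upper r s″ _ (λ b → ¬b (extend X repX (extend Y repY b)))
  vanish : ∀ {k l} (X : Vec (Fin n) k) (Y : Vec (Fin n) l) → 1 ≤ k → 1 ≤ l →
           head² (λ x y → ⟦ E x y ⟧) X Y ≡ 0 → ∀ v → link (link H X) Y v ≡ false
  vanish (x ∷ X) (y ∷ Y) _ _ eq v with E x y in Exy
  ... | false = cong (λ b → (b ∧ allᵇ (λ x′ → H (x′ ∷ y ∷ v)) X) ∧ allᵇ (λ y′ → link H (x ∷ X) (y′ ∷ v)) Y) (E-false x y v Exy)
  head²≤1 : ∀ {k l} (X : Vec (Fin n) k) (Y : Vec (Fin n) l) →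
            head² (λ x y → ⟦ E x y ⟧) X Y ≡ 0 ⊎ head² (λ x y → ⟦ E x y ⟧) X Y ≡ 1
  head²≤1 []      Y  = inj₁ refl
  head²≤1 (x ∷ X) [] = inj₁ refl
  head²≤1 (x ∷ X) (y ∷ Y) with E x y
  ... | true  = inj₂ refl
  ... | false = inj₁ refl
  bound : ∀ X Y → Bound (box r s″ (link (link H X) Y)) X Y
  bound X Y with head²≤1 X Y
  ... | inj₁ eq = ≤-trans (≤-reflexive (box-false r s″ (λ i → 1≤s (suc (suc i))) _
                    (vanish X Y (1≤s zero) (1≤s (suc zero)) eq))) z≤n
  ... | inj₂ eq rewrite eq = ≤-trans (bound′ X Y) (≤-reflexive (sym (+-identityʳ _)))
  -- The two sizes become variables here, so that positivity can be matched as `suc`.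
  go : ∀ k l → 1 ≤ k → 1 ≤ l → (b : Vec (Fin n) k → Vec (Fin n) l → ℕ) → (∀ X Y → Bound (b X Y) X Y) →
       n * n * ∑ (vecs n k) (λ X → ∑ (vecs n l) (b X)) ≤
       pairs E * ((triangular k + (triangular l + κ)) * n ^ (k + (l + σ)))
  go (suc k) (suc l) _ _ b b≤ = begin
    n * n * ∑ (vecs n (suc k)) (λ X → ∑ (vecs n (suc l)) (b X))
      ≤⟨ *-monoʳ-≤ (n * n) (∑-heads E (n ^ σ) κ k l b (λ x X y Y → b≤ (x ∷ X) (y ∷ Y))) ⟩
    n * n * (pairs E * (K * (n ^ k * (n ^ l * n ^ σ))))
      ≡⟨ arrange n (pairs E) K (n ^ k) (n ^ l) (n ^ σ) ⟩
    pairs E * (K * (n ^ suc k * (n ^ suc l * n ^ σ)))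
      ≡⟨ cong (λ a → pairs E * (K * a)) (trans (cong (n ^ suc k *_) (sym (^-distribˡ-+-* n (suc l) σ))) (sym (^-distribˡ-+-* n (suc k) (suc l + σ)))) ⟩
    pairs E * (K * n ^ (suc k + (suc l + σ))) ∎
    where
    open ≤-Reasoning
    K : ℕ
    K = triangular (suc k) + (triangular (suc l) + κ)
    arrange : ∀ n e K p q N → n * n * (e * (K * (p * (q * N)))) ≡ e * (K * (n * p * (n * q * N)))
    arrange = solve-∀

-- Cliques across lower-regular sets

# : (Fin n → Bool) → ℕ
# {n} A = ∑ (allFin n) (⟦_⟧ ∘ A)

infix 4 _⊆ᵇ_
_⊆ᵇ_ : (A B : Fin n → Bool) → Set
A ⊆ᵇ B = ∀ x → T (A x) → T (B x)

edges : (R : Fin n → Fin n → Bool) (X Y : Fin n → Bool) → ℕ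
edges {n} R X Y = ∑ (allFin n) λ x → ⟦ X x ⟧ * # (λ y → Y y ∧ R x y)

-- Every rectangle in `A` × `B` with at least a share 1/`q` of the area has density above 1/`t`.
-- Only a lower bound on density is asked for, and largeness concerns the area rather than each
-- side. The strict inequality forces `A` and `B` to be nonempty.
LowerRegular : (R : Fin n → Fin n → Bool) (q t : ℕ) (A B : Fin n → Bool) → Set
LowerRegular R q t A B = ∀ X Y → X ⊆ᵇ A → Y ⊆ᵇ B →
  # A * # B ≤ q * (# X * # Y) → # X * # Y < t * edges R X Y

-- A subset of share 1/`u` on each side shrinks the area by at most u², so rectangles large in the
-- subsets are still large in the original sets.
LowerRegular-mono : ∀ (R : Fin n → Fin n → Bool) q q′ t u {A B A′ B′} → u * u * q′ ≤ q →
  A′ ⊆ᵇ A → B′ ⊆ᵇ B → # A ≤ u * # A′ → # B ≤ u * # B′ →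
  LowerRegular R q t A B → LowerRegular R q′ t A′ B′
LowerRegular-mono R q q′ t u {A} {B} {A′} {B′} uuq′≤q A′⊆A B′⊆B A≤ B≤ reg X Y X⊆A′ Y⊆B′ large =
  reg X Y (λ x → A′⊆A x ∘ X⊆A′ x) (λ y → B′⊆B y ∘ Y⊆B′ y) (begin
    # A * # B                   ≤⟨ *-mono-≤ A≤ B≤ ⟩
    u * # A′ * (u * # B′)       ≡⟨ arrange u (# A′) (# B′) ⟩
    u * u * (# A′ * # B′)       ≤⟨ *-monoʳ-≤ (u * u) large ⟩
    u * u * (q′ * (# X * # Y))  ≡⟨ *-assoc (u * u) q′ _ ⟨
    u * u * q′ * (# X * # Y)    ≤⟨ *-monoˡ-≤ (# X * # Y) uuq′≤q ⟩
    q * (# X * # Y)             ∎)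
  where
  open ≤-Reasoning
  arrange : ∀ u a b → u * a * (u * b) ≡ u * u * (a * b)
  arrange = solve-∀

cliqueᵇ : ∀ {k} → (Fin n → Fin n → Bool) → Vec (Fin n) k → Bool
cliqueᵇ R []      = true
cliqueᵇ R (x ∷ v) = allᵇ (R x) v ∧ cliqueᵇ R v

_∈ᵖ_ : ∀ {k} → Vec (Fin n) k → Vec (Fin n → Bool) k → Bool
[]      ∈ᵖ []       = true
(x ∷ v) ∈ᵖ (A ∷ As) = A x ∧ v ∈ᵖ As

transversalCliques : ∀ {k} → (Fin n → Fin n → Bool) → Vec (Fin n → Bool) k → ℕ
transversalCliques R As = count (λ v → v ∈ᵖ As ∧ cliqueᵇ R v)

sizes : ∀ {k} → Vec (Fin n → Bool) k → ℕ
sizes []       = 1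
sizes (A ∷ As) = # A * sizes As

restrict : (Fin n → Bool) → (Fin n → Bool) → (Fin n → Bool)
restrict N A y = A y ∧ N y

-- Once the first vertex `x` is chosen, the rest is a transversal clique in the neighbourhoods of
-- `x`.
transversalCliques-∷ : ∀ {k} (R : Fin n → Fin n → Bool) A (As : Vec (Fin n → Bool) k) →
  transversalCliques R (A ∷ As) ≡
  ∑ (allFin n) (λ x → ⟦ A x ⟧ * transversalCliques R (Vec.map (restrict (R x)) As))
transversalCliques-∷ {n} {k} R A As = trans (∑-vecs n k _) (∑-cong (allFin n) λ x →
  trans (∑-cong (vecs n k) λ v → begin
    ⟦ (A x ∧ v ∈ᵖ As) ∧ (allᵇ (R x) v ∧ cliqueᵇ R v) ⟧       ≡⟨ cong ⟦_⟧ (regroup (A x) _ _ _) ⟩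
    ⟦ A x ∧ ((v ∈ᵖ As ∧ allᵇ (R x) v) ∧ cliqueᵇ R v) ⟧       ≡⟨ ⟦∧⟧ (A x) _ ⟩
    ⟦ A x ⟧ * ⟦ (v ∈ᵖ As ∧ allᵇ (R x) v) ∧ cliqueᵇ R v ⟧     ≡⟨ cong (λ b → ⟦ A x ⟧ * ⟦ b ∧ cliqueᵇ R v ⟧) (∈ᵖ-restrict (R x) v As) ⟨
    ⟦ A x ⟧ * ⟦ v ∈ᵖ Vec.map (restrict (R x)) As ∧ cliqueᵇ R v ⟧ ∎)
  (∑-*ˡ (vecs n k) ⟦ A x ⟧ _))
  where
  open ≡-Reasoning
  regroup : ∀ a b c d → (a ∧ b) ∧ (c ∧ d) ≡ a ∧ ((b ∧ c) ∧ d)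
  regroup true  true  c d = refl
  regroup true  false c d = refl
  regroup false b     c d = refl
  swap : ∀ a b c d → (a ∧ b) ∧ (c ∧ d) ≡ (a ∧ c) ∧ (b ∧ d)
  swap true  true  c     d = refl
  swap true  false true  d = refl
  swap true  false false d = refl
  swap false b     c     d = refl
  ∈ᵖ-restrict : ∀ {k} N (v : Vec (Fin n) k) As → v ∈ᵖ Vec.map (restrict N) As ≡ v ∈ᵖ As ∧ allᵇ N v
  ∈ᵖ-restrict N []      []       = refl
  ∈ᵖ-restrict N (x ∷ v) (A ∷ As) =
    trans (cong (restrict N A x ∧_) (∈ᵖ-restrict N v As)) (swap (A x) (N x) _ _)

typicalᵇ : ∀ {k} → (R : Fin n → Fin n → Bool) → ℕ → Vec (Fin n → Bool) k → Fin n → Bool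
typicalᵇ R t []       x = true
typicalᵇ R t (B ∷ Bs) x = (# B ≤ᵇ t * # (restrict (R x) B)) ∧ typicalᵇ R t Bs x

module _ (R : Fin n → Fin n → Bool) (q t : ℕ) (A : Fin n → Bool) where

  atypical : (B : Fin n → Bool) → Fin n → Bool
  atypical B x = A x ∧ not ((# B ≤ᵇ t * # (restrict (R x) B)))

  -- Atypical vertices together with all of `B` form a rectangle of density at most 1/`t`, so
  -- lower-regularity forbids it to be large.
  atypical-few : ∀ B → LowerRegular R q t A B → q * # (atypical B) ≤ # A
  atypical-few B reg with # A * # B ≤? q * (# (atypical B) * # B)
  ... | yes large = contradiction (reg X B X⊆A (λ _ → id) large) (≤⇒≯ sparse)
    where
    X : Fin n → Bool
    X = atypical B
    X⊆A : X ⊆ᵇ A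
    X⊆A x = proj₁ ∘ Equivalence.to T-∧
    pointwise : ∀ x → t * (⟦ X x ⟧ * # (restrict (R x) B)) ≤ ⟦ X x ⟧ * # B
    pointwise x with A x | # B ≤ᵇ t * # (restrict (R x) B) in B≰
    ... | false | _     = ≤-reflexive (*-zeroʳ t)
    ... | true  | true  = ≤-reflexive (*-zeroʳ t)
    ... | true  | false = begin
      t * (1 * # (restrict (R x) B)) ≡⟨ cong (t *_) (*-identityˡ _) ⟩
      t * # (restrict (R x) B)       ≤⟨ <⇒≤ (≰⇒> λ B≤ → subst T B≰ (≤⇒≤ᵇ B≤)) ⟩
      # B                            ≡⟨ *-identityˡ (# B) ⟨
      1 * # B                        ∎
      where open ≤-Reasoning
    sparse : t * edges R X B ≤ # X * # B
    sparse = begin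
      t * edges R X B                                                ≡⟨ ∑-*ˡ (allFin n) t _ ⟨
      ∑ (allFin n) (λ x → t * (⟦ X x ⟧ * # (restrict (R x) B)))      ≤⟨ ∑-mono (allFin n) pointwise ⟩
      ∑ (allFin n) (λ x → ⟦ X x ⟧ * # B)                             ≡⟨ ∑-*ʳ (allFin n) (# B) _ ⟩
      # X * # B                                                      ∎
      where open ≤-Reasoning
  ... | no small = <⇒≤ (*-cancelʳ-< (# B) (q * # (atypical B)) (# A)
                     (subst (_< # A * # B) (sym (*-assoc q (# (atypical B)) (# B))) (≰⇒> small)))

  -- Each of the `k` sets spoils at most a share 1/`q` of `A`.
  typical-many : ∀ {k} (Bs : Vec (Fin n → Bool) k) → All (LowerRegular R q t A) Bs →
    q * # A ≤ q * # (λ x → A x ∧ typicalᵇ R t Bs x) + k * # A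
  typical-many []       []          = ≤-trans
    (*-monoʳ-≤ q (≤-reflexive (∑-cong (allFin n) λ x → cong ⟦_⟧ (sym (∧-identityʳ (A x)))))) (m≤m+n _ 0)
  typical-many {suc k} (B ∷ Bs) (reg ∷ regs) = begin
    q * # A                                                ≤⟨ typical-many Bs regs ⟩
    q * # (λ x → A x ∧ typicalᵇ R t Bs x) + k * # A        ≤⟨ +-monoˡ-≤ (k * # A) (*-monoʳ-≤ q (∑-mono (allFin n) split)) ⟩
    q * ∑ (allFin n) (λ x → ⟦ A x ∧ typicalᵇ R t (B ∷ Bs) x ⟧ + ⟦ atypical B x ⟧) + k * # A
      ≡⟨ cong (λ a → q * a + k * # A) (∑-+ (allFin n) _ _) ⟩
    q * (G + # (atypical B)) + k * # A                     ≡⟨ arrange q G (# (atypical B)) (k * # A) ⟩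
    q * G + (q * # (atypical B) + k * # A)                 ≤⟨ +-monoʳ-≤ (q * G) (+-monoˡ-≤ (k * # A) (atypical-few B reg)) ⟩
    q * G + suc k * # A                                    ∎
    where
    open ≤-Reasoning
    G : ℕ
    G = # (λ x → A x ∧ typicalᵇ R t (B ∷ Bs) x)
    arrange : ∀ q a b c → q * (a + b) + c ≡ q * a + (q * b + c)
    arrange = solve-∀
    split : ∀ x → ⟦ A x ∧ typicalᵇ R t Bs x ⟧ ≤ ⟦ A x ∧ typicalᵇ R t (B ∷ Bs) x ⟧ + ⟦ atypical B x ⟧
    split x with A x | (# B ≤ᵇ t * # (restrict (R x) B))
    ... | false | _     = z≤n
    ... | true  | true  = m≤m+n _ 0
    ... | true  | false = ⟦⟧≤1 (typicalᵇ R t Bs x)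

  half-typical : ∀ {k} (Bs : Vec (Fin n → Bool) k) → All (LowerRegular R q t A) Bs →
    1 ≤ q → 2 * k ≤ q → # A ≤ 2 * # (λ x → A x ∧ typicalᵇ R t Bs x)
  half-typical {k} Bs regs 1≤q 2k≤q = *-cancelˡ-≤ q {{>-nonZero 1≤q}} (+-cancelʳ-≤ (q * # A) (q * # A) (q * (2 * G)) (begin
    q * # A + q * # A           ≡⟨ double (q * # A) ⟨
    2 * (q * # A)               ≤⟨ *-monoʳ-≤ 2 (typical-many Bs regs) ⟩
    2 * (q * G + k * # A)       ≡⟨ arrange q G k (# A) ⟩
    q * (2 * G) + 2 * k * # A   ≤⟨ +-monoʳ-≤ (q * (2 * G)) (*-monoˡ-≤ (# A) 2k≤q) ⟩
    q * (2 * G) + q * # A       ∎))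
    where
    open ≤-Reasoning
    G : ℕ
    G = # (λ x → A x ∧ typicalᵇ R t Bs x)
    double : ∀ a → 2 * a ≡ a + a
    double = solve-∀
    arrange : ∀ q g k a → 2 * (q * g + k * a) ≡ q * (2 * g) + 2 * k * a
    arrange = solve-∀

typical⇒All : ∀ {k} (R : Fin n → Fin n → Bool) t (Bs : Vec (Fin n → Bool) k) x → T (typicalᵇ R t Bs x) →
  All (λ B → # B ≤ t * # (restrict (R x) B)) Bs
typical⇒All R t []       x _ = []
typical⇒All R t (B ∷ Bs) x h with # B ≤ᵇ t * # (restrict (R x) B) in B≤
... | true = ≤ᵇ⇒≤ _ _ (subst T (sym B≤) _) ∷ typical⇒All R t Bs x h

sizes-restrict : ∀ {k} N t (Bs : Vec (Fin n → Bool) k) → All (λ B → # B ≤ t * # (restrict N B)) Bs →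
  sizes Bs ≤ t ^ k * sizes (Vec.map (restrict N) Bs)
sizes-restrict N t []       []        = ≤-refl
sizes-restrict {k = suc k} N t (B ∷ Bs) (B≤ ∷ Bs≤) = ≤-trans (*-mono-≤ B≤ (sizes-restrict N t Bs Bs≤))
  (≤-reflexive (arrange t (# (restrict N B)) (t ^ k) (sizes (Vec.map (restrict N) Bs))))
  where
  arrange : ∀ a b c d → a * b * (c * d) ≡ a * c * (b * d)
  arrange = solve-∀

regular-restrict : ∀ {k} (R : Fin n → Fin n → Bool) N q q′ t (Bs : Vec (Fin n → Bool) k) → t * t * q′ ≤ q →
  All (λ B → # B ≤ t * # (restrict N B)) Bs →
  AllPairs (LowerRegular R q t) Bs → AllPairs (LowerRegular R q′ t) (Vec.map (restrict N) Bs)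
regular-restrict R N q q′ t [] ttq′≤q [] [] = []
regular-restrict {n} R N q q′ t (B ∷ Bs) ttq′≤q (B≤ ∷ Bs≤) (reg ∷ regs) =
  one Bs Bs≤ reg ∷ regular-restrict R N q q′ t Bs ttq′≤q Bs≤ regs
  where
  restrict⊆ : ∀ C → restrict N C ⊆ᵇ C
  restrict⊆ C x = proj₁ ∘ Equivalence.to T-∧
  one : ∀ {k} (Cs : Vec (Fin n → Bool) k) → All (λ C → # C ≤ t * # (restrict N C)) Cs →
        All (LowerRegular R q t B) Cs → All (LowerRegular R q′ t (restrict N B)) (Vec.map (restrict N) Cs)
  one []       []          []          = []
  one (C ∷ Cs) (C≤ ∷ Cs≤) (reg ∷ regs) =
    LowerRegular-mono R q q′ t t ttq′≤q (restrict⊆ B) (restrict⊆ C) B≤ C≤ reg ∷ one Cs Cs≤ regs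

-- In `regularityConst`, the summand `2 * k` leaves half of a set typical for the `k` others, `suc`
-- keeps the constant positive, and `t * t` pays for passing to neighbourhoods on both sides. In
-- `cliqueConst`, 2 pays for the atypical half and `t ^ k` for shrinking `k` sets.
regularityConst cliqueConst : ℕ → ℕ → ℕ
regularityConst t zero    = 1
regularityConst t (suc k) = suc (2 * k) + t * t * regularityConst t k
cliqueConst t zero    = 1
cliqueConst t (suc k) = 2 * (t ^ k * cliqueConst t k)

-- Greedy embedding: at least half of `A` is typical, and for a typical `x` the neighbourhoods in
-- the other sets keep a share 1/`t` and stay lower-regular with the next constant.
counting : ∀ {k} (R : Fin n → Fin n → Bool) t (As : Vec (Fin n → Bool) k) →
  AllPairs (LowerRegular R (regularityConst t k) t) As →
  sizes As ≤ cliqueConst t k * transversalCliques R As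
counting R t [] [] = ≤-refl
counting {n} {suc k} R t (A ∷ As) (reg ∷ regs) = begin
  # A * sizes As                                        ≤⟨ *-monoˡ-≤ (sizes As) (half-typical R q t A As reg (s≤s z≤n) 2k≤q) ⟩
  2 * # G * sizes As                                    ≡⟨ *-assoc 2 (# G) (sizes As) ⟩
  2 * (# G * sizes As)                                  ≡⟨ cong (2 *_) (∑-*ʳ (allFin n) (sizes As) _) ⟨
  2 * ∑ (allFin n) (λ x → ⟦ G x ⟧ * sizes As)           ≤⟨ *-monoʳ-≤ 2 (∑-mono (allFin n) pointwise) ⟩
  2 * ∑ (allFin n) (λ x → c * (⟦ A x ⟧ * transversalCliques R (As′ x)))
    ≡⟨ cong (2 *_) (trans (∑-*ˡ (allFin n) c _) (cong (c *_) (sym (transversalCliques-∷ R A As)))) ⟩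
  2 * (c * transversalCliques R (A ∷ As))               ≡⟨ *-assoc 2 c _ ⟨
  2 * c * transversalCliques R (A ∷ As)                 ∎
  where
  open ≤-Reasoning
  q c : ℕ
  q = regularityConst t (suc k)
  c = t ^ k * cliqueConst t k
  2k≤q : 2 * k ≤ q
  2k≤q = ≤-trans (n≤1+n (2 * k)) (m≤m+n (suc (2 * k)) _)
  G : Fin n → Bool
  G x = A x ∧ typicalᵇ R t As x
  As′ : Fin n → Vec (Fin n → Bool) k
  As′ x = Vec.map (restrict (R x)) As
  pointwise : ∀ x → ⟦ G x ⟧ * sizes As ≤ c * (⟦ A x ⟧ * transversalCliques R (As′ x))
  pointwise x with A x | typicalᵇ R t As x in typ
  ... | false | _     = z≤n
  ... | true  | false = z≤n
  ... | true  | true  = begin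
    1 * sizes As                                  ≡⟨ *-identityˡ _ ⟩
    sizes As                                      ≤⟨ sizes-restrict (R x) t As large ⟩
    t ^ k * sizes (As′ x)                         ≤⟨ *-monoʳ-≤ (t ^ k) (counting R t (As′ x)
                                                       (regular-restrict R (R x) q (regularityConst t k) t As (m≤n+m _ (suc (2 * k))) large regs)) ⟩
    t ^ k * (cliqueConst t k * transversalCliques R (As′ x)) ≡⟨ *-assoc (t ^ k) (cliqueConst t k) _ ⟨
    c * transversalCliques R (As′ x)              ≡⟨ cong (c *_) (*-identityˡ _) ⟨
    c * (1 * transversalCliques R (As′ x))        ∎
    where
    large : All (λ B → # B ≤ t * # (restrict (R x) B)) As
    large = typical⇒All R t As x (subst T (sym typ) _)

#-cong : {A B : Fin n → Bool} → (∀ x → A x ≡ B x) → # A ≡ # B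
#-cong {n} A≡B = ∑-cong (allFin n) (cong ⟦_⟧ ∘ A≡B)

pairs-cong : {E F : Fin n → Fin n → Bool} → (∀ x y → E x y ≡ F x y) → pairs E ≡ pairs F
pairs-cong {n} E≡F = ∑-cong (allFin n) λ x → #-cong (E≡F x)

pairs-mono : {E F : Fin n → Fin n → Bool} → (∀ x y → ⟦ E x y ⟧ ≤ ⟦ F x y ⟧) → pairs E ≤ pairs F
pairs-mono {n} E≤F = ∑-mono (allFin n) λ x → ∑-mono (allFin n) (E≤F x)

pairs-+ : (E F G : Fin n → Fin n → Bool) → (∀ x y → ⟦ E x y ⟧ ≡ ⟦ F x y ⟧ + ⟦ G x y ⟧) →
          pairs E ≡ pairs F + pairs G
pairs-+ {n} E F G eq = trans
  (∑-cong (allFin n) λ x → trans (∑-cong (allFin n) (eq x)) (∑-+ (allFin n) _ _)) (∑-+ (allFin n) _ _)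

pairs-const : ∀ n b → pairs {n} (λ _ _ → b) ≡ n * (n * ⟦ b ⟧)
pairs-const n b = trans (∑-cong (allFin n) λ _ → ∑-allFin-const n ⟦ b ⟧) (∑-allFin-const n _)

pairs≤ : (E : Fin n → Fin n → Bool) → pairs E ≤ n * n
pairs≤ {n} E = ≤-trans (pairs-mono {E = E} {F = λ _ _ → true} (λ x y → ⟦⟧≤1 (E x y)))
  (≤-reflexive (trans (pairs-const n true) (cong (n *_) (*-identityʳ n))))

-- One-sided regular partitions

Sparse : (R : Fin n → Fin n → Bool) (q t : ℕ) (A B X Y : Fin n → Bool) → Set
Sparse R q t A B X Y =
  X ⊆ᵇ A × Y ⊆ᵇ B × # A * # B ≤ q * (# X * # Y) × t * edges R X Y ≤ # X * # Y

-- The witnesses are subsets, not predicates, so that irregularity can be decided by exhaustive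
-- search.
Irregular : (R : Fin n → Fin n → Bool) (q t : ℕ) (A B : Fin n → Bool) → Set
Irregular {n} R q t A B = ∃ λ (X : Subset n) → ∃ λ (Y : Subset n) → Sparse R q t A B (lookup X) (lookup Y)

opaque
  irregular? : ∀ (R : Fin n → Fin n → Bool) q t A B → Dec (Irregular R q t A B)
  irregular? {n} R q t A B = anySubset? λ X → anySubset? λ Y →
    (lookup X ⊆? A) ×-dec (lookup Y ⊆? B) ×-dec (_ ≤? _) ×-dec (_ ≤? _)
    where
    _⊆?_ : ∀ (X A : Fin n → Bool) → Dec (X ⊆ᵇ A)
    X ⊆? A = F.all? λ x → T? (X x) →-dec T? (A x)

¬irregular⇒regular : ∀ (R : Fin n → Fin n → Bool) q t {A B} →
  ¬ Irregular R q t A B → LowerRegular R q t A B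
¬irregular⇒regular {n} R q t {A} {B} ¬irr X Y X⊆A Y⊆B large = ≰⇒> λ sparse → ¬irr
  ( tabulate X , tabulate Y
  , (λ x → X⊆A x ∘ subst T (lookup∘tabulate X x))
  , (λ y → Y⊆B y ∘ subst T (lookup∘tabulate Y y))
  , subst (λ a → # A * # B ≤ q * a) (sym sizes≡) large
  , subst₂ (λ a b → t * a ≤ b) (sym edges≡) (sym sizes≡) sparse )
  where
  sizes≡ : # (lookup (tabulate X)) * # (lookup (tabulate Y)) ≡ # X * # Y
  sizes≡ = cong₂ _*_ (#-cong (lookup∘tabulate X)) (#-cong (lookup∘tabulate Y))
  edges≡ : edges R (lookup (tabulate X)) (lookup (tabulate Y)) ≡ edges R X Y
  edges≡ = ∑-cong (allFin n) λ x → cong₂ _*_ (cong ⟦_⟧ (lookup∘tabulate X x))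
    (#-cong λ y → cong (_∧ R x y) (lookup∘tabulate Y y))

-- Partitions and one round of refinement.

cell : ∀ {m} → (Fin n → Fin m) → Fin m → Fin n → Bool
cell P a x = does (P x F.≟ a)

cell⇒≡ : ∀ {m} (P : Fin n → Fin m) {a x} → T (cell P a x) → P x ≡ a
cell⇒≡ P {a} {x} h with P x F.≟ a
... | yes Px≡a = Px≡a

∑-fibres : ∀ {m} (P : Fin n → Fin m) (f : Fin n → ℕ) →
  ∑ (allFin n) f ≡ ∑ (allFin m) (λ a → ∑ (allFin n) λ x → ⟦ cell P a x ⟧ * f x)
∑-fibres {n} {m} P f = trans (∑-cong (allFin n) λ x → sym (∑-δ (P x) (λ _ → f x))) (∑-comm (allFin n) (allFin m) _)

∑∑-fibres : ∀ {m} (P : Fin n → Fin m) (f : Fin n → Fin n → ℕ) →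
  ∑ (allFin n) (λ x → ∑ (allFin n) (f x)) ≡
  ∑ (allFin m) (λ a → ∑ (allFin m) λ b →
    ∑ (allFin n) λ x → ∑ (allFin n) λ y → ⟦ cell P a x ⟧ * (⟦ cell P b y ⟧ * f x y))
∑∑-fibres {n} {m} P f = trans (∑-fibres P _) (∑-cong (allFin m) λ a → begin
  ∑ (allFin n) (λ x → ⟦ cell P a x ⟧ * ∑ (allFin n) (f x))
    ≡⟨ ∑-cong (allFin n) (λ x → trans (cong (⟦ cell P a x ⟧ *_) (∑-fibres P (f x)))
         (trans (sym (∑-*ˡ (allFin m) ⟦ cell P a x ⟧ _))
           (∑-cong (allFin m) λ b → sym (∑-*ˡ (allFin n) ⟦ cell P a x ⟧ _)))) ⟩
  ∑ (allFin n) (λ x → ∑ (allFin m) λ b → ∑ (allFin n) λ y → ⟦ cell P a x ⟧ * (⟦ cell P b y ⟧ * f x y))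
    ≡⟨ ∑-comm (allFin n) (allFin m) _ ⟩
  ∑ (allFin m) (λ b → ∑ (allFin n) λ x → ∑ (allFin n) λ y → ⟦ cell P a x ⟧ * (⟦ cell P b y ⟧ * f x y)) ∎)
  where open ≡-Reasoning

-- A refined cell records the old cell and, for each of the `m` old cells as partner, one bit for
-- membership in the first side of the chosen rectangle and one for the second side.
colours : ℕ → ℕ
colours m = m * (2 ^ m * 2 ^ m)

module _ {m : ℕ} where

  encode : Fin m → (Fin m → Bool) → (Fin m → Bool) → Fin (colours m)
  encode a f g = combine a (combine (funToFin (Inverse.from F.2↔Bool ∘ f)) (funToFin (Inverse.from F.2↔Bool ∘ g)))

  old : Fin (colours m) → Fin m
  old c = proj₁ (remQuot (2 ^ m * 2 ^ m) c)

  bits : Fin (2 ^ m) → Fin m → Bool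
  bits k i = Inverse.to F.2↔Bool (finToFun k i)

  bits₁ bits₂ : Fin (colours m) → Fin m → Bool
  bits₁ c = bits (proj₁ (remQuot {2 ^ m} (2 ^ m) (proj₂ (remQuot {m} (2 ^ m * 2 ^ m) c))))
  bits₂ c = bits (proj₂ (remQuot {2 ^ m} (2 ^ m) (proj₂ (remQuot {m} (2 ^ m * 2 ^ m) c))))

  bits-funToFin : ∀ f i → bits (funToFin (Inverse.from F.2↔Bool ∘ f)) i ≡ f i
  bits-funToFin f i = trans (cong (Inverse.to F.2↔Bool) (F.finToFun-funToFin (Inverse.from F.2↔Bool ∘ f) i))
                            (Inverse.strictlyInverseˡ F.2↔Bool (f i))

  old-encode : ∀ a f g → old (encode a f g) ≡ a
  old-encode a f g = cong proj₁ (F.remQuot-combine {m} {2 ^ m * 2 ^ m} a _)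

  bits₁-encode : ∀ a f g i → bits₁ (encode a f g) i ≡ f i
  bits₁-encode a f g i = trans
    (cong (λ p → bits (proj₁ (remQuot {2 ^ m} (2 ^ m) (proj₂ p))) i) (F.remQuot-combine {m} {2 ^ m * 2 ^ m} a _))
    (trans (cong (λ p → bits (proj₁ p) i) (F.remQuot-combine {2 ^ m} {2 ^ m} _ _)) (bits-funToFin f i))

  bits₂-encode : ∀ a f g i → bits₂ (encode a f g) i ≡ g i
  bits₂-encode a f g i = trans
    (cong (λ p → bits (proj₂ (remQuot {2 ^ m} (2 ^ m) (proj₂ p))) i) (F.remQuot-combine {m} {2 ^ m * 2 ^ m} a _))
    (trans (cong (λ p → bits (proj₂ p) i) (F.remQuot-combine {2 ^ m} {2 ^ m} _ _)) (bits-funToFin g i))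

-- `P` assigns vertices to cells and `D` marks the dead pairs of cells; the round produces `P′` and
-- `D′`.
module Refinement {n m : ℕ} (R : Fin n → Fin n → Bool) (q t : ℕ)
                  (P : Fin n → Fin m) (D : Fin m → Fin m → Bool) where

  bad : Fin m → Fin m → Bool
  bad a b = not (D a b) ∧ does (irregular? R q t (cell P a) (cell P b))

  -- Every pair of cells gets a rectangle, possibly empty. The weight in `large` demands area only
  -- from bad pairs, and `alive` keeps the rectangles away from area that is already dead.
  record Rectangle (a b : Fin m) : Set where
    field
      X Y    : Fin n → Bool
      X⊆     : X ⊆ᵇ cell P a
      Y⊆     : Y ⊆ᵇ cell P b
      sparse : t * edges R X Y ≤ # X * # Y
      large  : ⟦ bad a b ⟧ * (# (cell P a) * # (cell P b)) ≤ q * (# X * # Y)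
      alive  : D a b ≡ true → ∀ x → X x ≡ false

  rectangle : ∀ a b → Rectangle a b
  rectangle a b with D a b in Dab | irregular? R q t (cell P a) (cell P b) in irr
  ... | false | yes (X , Y , X⊆ , Y⊆ , large , sparse) = record
    { X = lookup X ; Y = lookup Y ; X⊆ = X⊆ ; Y⊆ = Y⊆ ; sparse = sparse
    ; large = ≤-trans (≤-trans (*-monoˡ-≤ _ (⟦⟧≤1 (bad a b))) (≤-reflexive (*-identityˡ _))) large
    ; alive = λ D≡true → contradiction (trans (sym D≡true) Dab) λ () }
  ... | false | no _  = record
    { X = λ _ → false ; Y = λ _ → false ; X⊆ = λ _ () ; Y⊆ = λ _ ()
    ; sparse = ≤-trans (≤-reflexive (trans (cong (t *_) (trans (∑-allFin-const n 0) (*-zeroʳ n))) (*-zeroʳ t))) z≤n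
    ; large = ≤-trans (≤-reflexive (cong (λ c → ⟦ c ⟧ * _) (cong₂ (λ d i → not d ∧ does i) Dab irr))) z≤n
    ; alive = λ _ _ → refl }
  ... | true  | _     = record
    { X = λ _ → false ; Y = λ _ → false ; X⊆ = λ _ () ; Y⊆ = λ _ ()
    ; sparse = ≤-trans (≤-reflexive (trans (cong (t *_) (trans (∑-allFin-const n 0) (*-zeroʳ n))) (*-zeroʳ t))) z≤n
    ; large = ≤-trans (≤-reflexive (cong (λ d → ⟦ not d ∧ does (irregular? R q t (cell P a) (cell P b)) ⟧ * _) Dab)) z≤n
    ; alive = λ _ _ → refl }

  Xs Ys : Fin m → Fin m → Fin n → Bool
  Xs a b = Rectangle.X (rectangle a b)
  Ys a b = Rectangle.Y (rectangle a b)

  killed : Fin n → Fin n → Bool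
  killed x y = Xs (P x) (P y) x ∧ Ys (P x) (P y) y

  killed-in-cell : ∀ a b w x y →
    ⟦ cell P a x ⟧ * (⟦ cell P b y ⟧ * ⟦ killed x y ∧ w ⟧) ≡ ⟦ Xs a b x ⟧ * ⟦ Ys a b y ∧ w ⟧
  killed-in-cell a b w x y with P x F.≟ a
  ... | no Px≢a with Xs a b x in Xx
  ...   | true  = contradiction (cell⇒≡ P (Rectangle.X⊆ (rectangle a b) x (subst T (sym Xx) _))) Px≢a
  ...   | false = refl
  killed-in-cell a b w x y | yes refl with P y F.≟ b
  ... | no Py≢b with Ys a b y in Yy
  ...   | true  = contradiction (cell⇒≡ P (Rectangle.Y⊆ (rectangle a b) y (subst T (sym Yy) _))) Py≢b
  ...   | false = sym (*-zeroʳ ⟦ Xs (P x) b x ⟧)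
  killed-in-cell a b w x y | yes refl | yes refl with Xs (P x) (P y) x
  ... | true  = trans (*-identityˡ _) refl
  ... | false = refl

  -- Rectangles stay inside their own pair of cells, so they are disjoint and can be summed pair by
  -- pair. `W` is `R` for counting edges and constantly true for area.
  pairs-killed : ∀ (W : Fin n → Fin n → Bool) →
    pairs (λ x y → killed x y ∧ W x y) ≡
    ∑ (allFin m) (λ a → ∑ (allFin m) λ b → edges W (Xs a b) (Ys a b))
  pairs-killed W = trans (∑∑-fibres P _) (∑-cong (allFin m) λ a → ∑-cong (allFin m) λ b →
    ∑-cong (allFin n) λ x → trans (∑-cong (allFin n) λ y → killed-in-cell a b (W x y) x y)
      (∑-*ˡ (allFin n) ⟦ Xs a b x ⟧ _))

  area-killed : pairs killed ≡ ∑ (allFin m) (λ a → ∑ (allFin m) λ b → # (Xs a b) * # (Ys a b))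
  area-killed = begin
    pairs killed                        ≡⟨ pairs-cong (λ x y → ∧-identityʳ (killed x y)) ⟨
    pairs (λ x y → killed x y ∧ true)   ≡⟨ pairs-killed (λ _ _ → true) ⟩
    ∑ (allFin m) (λ a → ∑ (allFin m) λ b → edges (λ _ _ → true) (Xs a b) (Ys a b))
      ≡⟨ ∑-cong (allFin m) (λ a → ∑-cong (allFin m) λ b →
           trans (∑-*ʳ (allFin n) _ _) (cong (# (Xs a b) *_) (#-cong λ y → ∧-identityʳ (Ys a b y)))) ⟩
    ∑ (allFin m) (λ a → ∑ (allFin m) λ b → # (Xs a b) * # (Ys a b)) ∎
    where open ≡-Reasoning

  killed-sparse : t * pairs (λ x y → killed x y ∧ R x y) ≤ pairs killed
  killed-sparse = begin
    t * pairs (λ x y → killed x y ∧ R x y)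
      ≡⟨ cong (t *_) (pairs-killed R) ⟩
    t * ∑ (allFin m) (λ a → ∑ (allFin m) λ b → edges R (Xs a b) (Ys a b))
      ≡⟨ trans (∑-cong (allFin m) λ a → ∑-*ˡ (allFin m) t _) (∑-*ˡ (allFin m) t _) ⟨
    ∑ (allFin m) (λ a → ∑ (allFin m) λ b → t * edges R (Xs a b) (Ys a b))
      ≤⟨ ∑-mono (allFin m) (λ a → ∑-mono (allFin m) λ b → Rectangle.sparse (rectangle a b)) ⟩
    ∑ (allFin m) (λ a → ∑ (allFin m) λ b → # (Xs a b) * # (Ys a b))
      ≡⟨ area-killed ⟨
    pairs killed ∎
    where open ≤-Reasoning

  -- Each bad pair of cells loses a rectangle of at least a share 1/`q` of its area.
  bad≤killed : pairs (λ x y → bad (P x) (P y)) ≤ q * pairs killed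
  bad≤killed = begin
    pairs (λ x y → bad (P x) (P y))
      ≡⟨ ∑∑-fibres P _ ⟩
    ∑ (allFin m) (λ a → ∑ (allFin m) λ b →
      ∑ (allFin n) λ x → ∑ (allFin n) λ y → ⟦ cell P a x ⟧ * (⟦ cell P b y ⟧ * ⟦ bad (P x) (P y) ⟧))
      ≡⟨ ∑-cong (allFin m) (λ a → ∑-cong (allFin m) λ b →
           trans (∑-cong (allFin n) λ x → ∑-cong (allFin n) λ y → in-cell a b x y)
             (trans (∑-× (allFin n) (allFin n) (λ x → ⟦ cell P a x ⟧) (λ y → ⟦ bad a b ⟧ * ⟦ cell P b y ⟧))
             (trans (*-comm (# (cell P a)) _) (trans (cong (_* # (cell P a)) (∑-*ˡ (allFin n) ⟦ bad a b ⟧ _))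
                (arrange ⟦ bad a b ⟧ (# (cell P b)) (# (cell P a))))))) ⟩
    ∑ (allFin m) (λ a → ∑ (allFin m) λ b → ⟦ bad a b ⟧ * (# (cell P a) * # (cell P b)))
      ≤⟨ ∑-mono (allFin m) (λ a → ∑-mono (allFin m) λ b → Rectangle.large (rectangle a b)) ⟩
    ∑ (allFin m) (λ a → ∑ (allFin m) λ b → q * (# (Xs a b) * # (Ys a b)))
      ≡⟨ trans (∑-cong (allFin m) λ a → ∑-*ˡ (allFin m) q _) (∑-*ˡ (allFin m) q _) ⟩
    q * ∑ (allFin m) (λ a → ∑ (allFin m) λ b → # (Xs a b) * # (Ys a b))
      ≡⟨ cong (q *_) area-killed ⟨
    q * pairs killed ∎
    where
    open ≤-Reasoning
    arrange : ∀ a b c → a * b * c ≡ a * (c * b)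
    arrange = solve-∀
    in-cell : ∀ a b x y → ⟦ cell P a x ⟧ * (⟦ cell P b y ⟧ * ⟦ bad (P x) (P y) ⟧)
                        ≡ ⟦ cell P a x ⟧ * (⟦ bad a b ⟧ * ⟦ cell P b y ⟧)
    in-cell a b x y with P x F.≟ a | P y F.≟ b
    ... | no _     | _        = refl
    ... | yes _    | no _     = cong (1 *_) (sym (*-zeroʳ ⟦ bad a b ⟧))
    ... | yes refl | yes refl = cong (1 *_) (*-comm 1 ⟦ bad (P x) (P y) ⟧)

  inX inY : Fin n → Fin m → Bool
  inX x b = Xs (P x) b x
  inY y a = Ys a (P y) y

  P′ : Fin n → Fin (colours m)
  P′ x = encode (P x) (inX x) (inY x)

  -- Whether a pair of vertices lies in its rectangle can be read off the two colours: the first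
  -- bits of one at the old cell of the other, and the second bits vice versa. So death is a
  -- property of pairs of new cells.
  D′ : Fin (colours m) → Fin (colours m) → Bool
  D′ c d = D (old {m} c) (old {m} d) ∨ (bits₁ {m} c (old {m} d) ∧ bits₂ {m} d (old {m} c))

  D′-P′ : ∀ x y → D′ (P′ x) (P′ y) ≡ D (P x) (P y) ∨ killed x y
  D′-P′ x y = cong₂ _∨_
    (cong₂ D (old-encode (P x) (inX x) (inY x)) (old-encode (P y) (inX y) (inY y)))
    (cong₂ _∧_
      (trans (cong (bits₁ {m} (P′ x)) (old-encode (P y) (inX y) (inY y))) (bits₁-encode (P x) (inX x) (inY x) (P y)))
      (trans (cong (bits₂ {m} (P′ y)) (old-encode (P x) (inX x) (inY x))) (bits₂-encode (P y) (inX y) (inY y) (P x))))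

  D⇒¬killed : ∀ x y → D (P x) (P y) ≡ true → killed x y ≡ false
  D⇒¬killed x y d = cong (_∧ Ys (P x) (P y) y) (Rectangle.alive (rectangle (P x) (P y)) d x)

  -- The newly killed area is disjoint from the dead area, so both edges and areas add exactly.
  -- Hence the dead area stays sparse and the alive area drops by precisely the killed area.
  D′-split : ∀ (w : Bool) x y →
    ⟦ D′ (P′ x) (P′ y) ∧ w ⟧ ≡ ⟦ D (P x) (P y) ∧ w ⟧ + ⟦ killed x y ∧ w ⟧
  D′-split w x y = trans (cong (λ b → ⟦ b ∧ w ⟧) (D′-P′ x y)) (split (D (P x) (P y)) (killed x y) (D⇒¬killed x y))
    where
    split : ∀ d k → (d ≡ true → k ≡ false) → ⟦ (d ∨ k) ∧ w ⟧ ≡ ⟦ d ∧ w ⟧ + ⟦ k ∧ w ⟧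
    split false k _ = refl
    split true  k h = trans (sym (+-identityʳ ⟦ w ⟧)) (cong (λ b → ⟦ w ⟧ + ⟦ b ∧ w ⟧) (sym (h refl)))

  dead-sparse : t * pairs (λ x y → D (P x) (P y) ∧ R x y) ≤ pairs (λ x y → D (P x) (P y)) →
                t * pairs (λ x y → D′ (P′ x) (P′ y) ∧ R x y) ≤ pairs (λ x y → D′ (P′ x) (P′ y))
  dead-sparse h = begin
    t * pairs (λ x y → D′ (P′ x) (P′ y) ∧ R x y)
      ≡⟨ cong (t *_) (pairs-+ _ _ _ (λ x y → D′-split (R x y) x y)) ⟩
    t * (pairs (λ x y → D (P x) (P y) ∧ R x y) + pairs (λ x y → killed x y ∧ R x y))
      ≡⟨ *-distribˡ-+ t _ _ ⟩
    t * pairs (λ x y → D (P x) (P y) ∧ R x y) + t * pairs (λ x y → killed x y ∧ R x y)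
      ≤⟨ +-mono-≤ h killed-sparse ⟩
    pairs (λ x y → D (P x) (P y)) + pairs killed
      ≡⟨ pairs-+ _ _ _ (λ x y → trans (cong ⟦_⟧ (sym (∧-identityʳ (D′ (P′ x) (P′ y))))) (trans (D′-split true x y)
           (cong₂ _+_ (cong ⟦_⟧ (∧-identityʳ (D (P x) (P y)))) (cong ⟦_⟧ (∧-identityʳ (killed x y)))))) ⟨
    pairs (λ x y → D′ (P′ x) (P′ y)) ∎
    where open ≤-Reasoning

  alive-split : pairs (λ x y → not (D (P x) (P y))) ≡ pairs (λ x y → not (D′ (P′ x) (P′ y))) + pairs killed
  alive-split = pairs-+ _ _ _ λ x y → trans (split (D (P x) (P y)) (killed x y) (D⇒¬killed x y))
    (cong (λ b → ⟦ not b ⟧ + ⟦ killed x y ⟧) (sym (D′-P′ x y)))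
    where
    split : ∀ d k → (d ≡ true → k ≡ false) → ⟦ not d ⟧ ≡ ⟦ not (d ∨ k) ⟧ + ⟦ k ⟧
    split false false _ = refl
    split false true  _ = refl
    split true  k     h = cong ⟦_⟧ (sym (h refl))

-- The bound `M` on the number of cells is a parameter so that it can be chosen independently of
-- `n`. Pairs neither dead nor bad are lower-regular.
record RegularPartition {n} (R : Fin n → Fin n → Bool) (L q t M : ℕ) : Set where
  field
    m           : ℕ
    m≤M         : m ≤ M
    P           : Fin n → Fin m
    D           : Fin m → Fin m → Bool
    dead-sparse : t * pairs (λ x y → D (P x) (P y) ∧ R x y) ≤ pairs (λ x y → D (P x) (P y))
    few-bad     : L * pairs (λ x y → Refinement.bad R q t P D (P x) (P y)) ≤ n * n

-- A maximum over all rounds, since the refinement may stop at any of them.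
cellBound : ℕ → ℕ → ℕ
cellBound zero    m = m
cellBound (suc f) m = m ⊔ cellBound f (colours m)

m≤cellBound : ∀ f m → m ≤ cellBound f m
m≤cellBound zero    m = ≤-refl
m≤cellBound (suc f) m = m≤m⊔n m _

-- f bounds the number of rounds still possible, since each kills an area of more than n²/Lq.
regularise : ∀ (R : Fin n → Fin n → Bool) L q t → 1 ≤ q → ∀ f {m} (P : Fin n → Fin m) D →
  t * pairs (λ x y → D (P x) (P y) ∧ R x y) ≤ pairs (λ x y → D (P x) (P y)) →
  L * q * pairs (λ x y → not (D (P x) (P y))) ≤ f * (n * n) →
  RegularPartition R L q t (cellBound f m)
regularise {n} R L q t 1≤q f {m} P D sparse alive≤
  with L * pairs (λ x y → Refinement.bad R q t P D (P x) (P y)) ≤? n * n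
... | yes few = record { m = m ; m≤M = m≤cellBound f m ; P = P ; D = D ; dead-sparse = sparse ; few-bad = few }
-- With no round left the alive area, weighted by `L * q`, is 0, and bad pairs are alive.
regularise {n} R L q t 1≤q zero {m} P D sparse alive≤ | no many = contradiction (begin
  L * pairs (λ x y → bad (P x) (P y))      ≤⟨ *-monoʳ-≤ L (pairs-mono bad≤alive) ⟩
  L * pairs (λ x y → not (D (P x) (P y)))  ≡⟨ cong (_* pairs (λ x y → not (D (P x) (P y)))) (*-identityʳ L) ⟨
  L * 1 * pairs (λ x y → not (D (P x) (P y))) ≤⟨ *-monoˡ-≤ _ (*-monoʳ-≤ L 1≤q) ⟩
  L * q * pairs (λ x y → not (D (P x) (P y))) ≤⟨ alive≤ ⟩
  0                                        ≤⟨ z≤n ⟩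
  n * n                                    ∎) many
  where
  open ≤-Reasoning
  open Refinement R q t P D using (bad)
  bad≤alive : ∀ x y → ⟦ bad (P x) (P y) ⟧ ≤ ⟦ not (D (P x) (P y)) ⟧
  bad≤alive x y with D (P x) (P y)
  ... | true  = z≤n
  ... | false = ⟦⟧≤1 _
regularise {n} R L q t 1≤q (suc f) {m} P D sparse alive≤ | no many =
  record { RegularPartition rest ; m≤M = ≤-trans (RegularPartition.m≤M rest) (m≤n⊔m m _) }
  where
  open Refinement R q t P D
  open ≤-Reasoning
  alive′ κ : ℕ
  alive′ = pairs (λ x y → not (D′ (P′ x) (P′ y)))
  κ = pairs killed
  rest : RegularPartition R L q t (cellBound f (colours m))
  rest = regularise R L q t 1≤q f P′ D′ (dead-sparse sparse) (+-cancelˡ-≤ (n * n) _ _ (begin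
    n * n + L * q * alive′       ≤⟨ +-monoˡ-≤ _ (<⇒≤ (≰⇒> many)) ⟩
    L * pairs (λ x y → bad (P x) (P y)) + L * q * alive′ ≤⟨ +-monoˡ-≤ _ (*-monoʳ-≤ L bad≤killed) ⟩
    L * (q * κ) + L * q * alive′ ≡⟨ arrange L q κ alive′ ⟩
    L * q * (alive′ + κ)         ≡⟨ cong (L * q *_) alive-split ⟨
    L * q * pairs (λ x y → not (D (P x) (P y))) ≤⟨ alive≤ ⟩
    suc f * (n * n)              ∎))
    where
    arrange : ∀ a b c d → a * (b * c) + a * b * d ≡ a * b * (d + c)
    arrange = solve-∀

-- Start from a single cell with nothing dead. The alive area is then at most n², which allows
-- `L * q` rounds.
regularPartition : ∀ (R : Fin n → Fin n → Bool) L q t → 1 ≤ q → RegularPartition R L q t (cellBound (L * q) 1)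
regularPartition {n} R L q t 1≤q = regularise R L q t 1≤q (L * q) (λ _ → zero) (λ _ _ → false)
  (≤-trans (≤-reflexive (trans (cong (t *_) (trans (pairs-const n false) (trans (cong (n *_) (*-zeroʳ n)) (*-zeroʳ n)))) (*-zeroʳ t))) z≤n)
  (*-monoʳ-≤ (L * q) (pairs≤ {n} (λ _ _ → true)))

-- Clique removal

module Cleaning {n L q M : ℕ} (R : Fin n → Fin n → Bool) (1≤M : 1 ≤ M) (ρ : RegularPartition R L q L M) where
  open RegularPartition ρ
  open Refinement R q L P D using (bad)

  small : Fin m → Bool
  small a = # (cell P a) * (L * M) ≤ᵇ n

  -- There are at most `M` cells, and each small one has at most n/(LM) vertices.
  count-small : L * # (small ∘ P) ≤ n
  count-small = *-cancelˡ-≤ M {{>-nonZero 1≤M}} (begin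
    M * (L * # (small ∘ P))
      ≡⟨ arrange M L (# (small ∘ P)) ⟩
    # (small ∘ P) * (L * M)
      ≡⟨ cong (_* (L * M)) (trans (∑-fibres P _) (∑-cong (allFin m) λ a →
           trans (∑-cong (allFin n) (in-cell a)) (∑-*ˡ (allFin n) ⟦ small a ⟧ _))) ⟩
    ∑ (allFin m) (λ a → ⟦ small a ⟧ * # (cell P a)) * (L * M)
      ≡⟨ ∑-*ʳ (allFin m) (L * M) _ ⟨
    ∑ (allFin m) (λ a → ⟦ small a ⟧ * # (cell P a) * (L * M))
      ≤⟨ ∑-mono (allFin m) small≤ ⟩
    ∑ (allFin m) (λ _ → n)
      ≡⟨ ∑-allFin-const m n ⟩
    m * n
      ≤⟨ *-monoˡ-≤ n m≤M ⟩
    M * n ∎)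
    where
    open ≤-Reasoning
    arrange : ∀ a b c → a * (b * c) ≡ c * (b * a)
    arrange = solve-∀
    in-cell : ∀ a x → ⟦ cell P a x ⟧ * ⟦ small (P x) ⟧ ≡ ⟦ small a ⟧ * ⟦ cell P a x ⟧
    in-cell a x with P x F.≟ a
    ... | yes refl = *-comm 1 ⟦ small (P x) ⟧
    ... | no _     = sym (*-zeroʳ ⟦ small a ⟧)
    small≤ : ∀ a → ⟦ small a ⟧ * # (cell P a) * (L * M) ≤ n
    small≤ a with small a in sm
    ... | false = z≤n
    ... | true  = ≤-trans (≤-reflexive (cong (_* (L * M)) (*-identityˡ (# (cell P a)))))
                          (≤ᵇ⇒≤ _ _ (subst T (sym sm) _))

  -- Only pairs of `R` are removed. Dead pairs of cells thus cost few removals, and for a graph the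
  -- two vertices of a removed pair are distinct.
  junk removed : Fin n → Fin n → Bool
  junk x y = bad (P x) (P y) ∨ (small (P x) ∨ small (P y))
  removed x y = R x y ∧ (D (P x) (P y) ∨ junk x y)

  -- Four sources contribute at most n²/L each: edges in dead pairs, bad pairs, and small cells on
  -- the left and on the right.
  removed-few : L * pairs removed ≤ 4 * (n * n)
  removed-few = begin
    L * pairs removed ≤⟨ *-monoʳ-≤ L total ⟩
    L * (d + (b + (s₁ + s₂))) ≡⟨ distribute L d b s₁ s₂ ⟩
    L * d + (L * b + (L * s₁ + L * s₂)) ≤⟨ +-mono-≤ (≤-trans dead-sparse (pairs≤ (λ x y → D (P x) (P y)))) (+-mono-≤ few-bad (+-mono-≤ few₁ few₂)) ⟩
    n * n + (n * n + (n * n + n * n)) ≡⟨ four (n * n) ⟩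
    4 * (n * n) ∎
    where
    open ≤-Reasoning
    d b s₁ s₂ : ℕ
    d  = pairs (λ x y → D (P x) (P y) ∧ R x y)
    b  = pairs (λ x y → bad (P x) (P y))
    s₁ = pairs (λ x y → small (P x))
    s₂ = pairs (λ x y → small (P y))
    distribute : ∀ L a b c d → L * (a + (b + (c + d))) ≡ L * a + (L * b + (L * c + L * d))
    distribute = solve-∀
    four : ∀ a → a + (a + (a + a)) ≡ 4 * a
    four = solve-∀
    few₂ : L * s₂ ≤ n * n
    few₂ = begin
      L * s₂                    ≡⟨ cong (L *_) (∑-allFin-const n _) ⟩
      L * (n * # (small ∘ P))   ≡⟨ swap L n (# (small ∘ P)) ⟩
      n * (L * # (small ∘ P))   ≤⟨ *-monoʳ-≤ n count-small ⟩
      n * n                     ∎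
      where
      swap : ∀ a b c → a * (b * c) ≡ b * (a * c)
      swap = solve-∀
    few₁ : L * s₁ ≤ n * n
    few₁ = ≤-trans (≤-reflexive (cong (L *_) (∑-comm (allFin n) (allFin n) _))) few₂
    split : ∀ r d b s s′ → ⟦ r ∧ (d ∨ (b ∨ (s ∨ s′))) ⟧ ≤ ⟦ d ∧ r ⟧ + (⟦ b ⟧ + (⟦ s ⟧ + ⟦ s′ ⟧))
    split false d     b     s     s′ = z≤n
    split true  true  b     s     s′ = s≤s z≤n
    split true  false b     s     s′ = ≤-trans (⟦∨⟧ b (s ∨ s′)) (+-monoʳ-≤ ⟦ b ⟧ (⟦∨⟧ s s′))
    total : pairs removed ≤ d + (b + (s₁ + s₂))
    total = begin
      pairs removed
        ≤⟨ ∑-mono (allFin n) (λ x → ∑-mono (allFin n) λ y → split (R x y) (D (P x) (P y)) (bad (P x) (P y)) (small (P x)) (small (P y))) ⟩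
      ∑ (allFin n) (λ x → ∑ (allFin n) λ y →
        ⟦ D (P x) (P y) ∧ R x y ⟧ + (⟦ bad (P x) (P y) ⟧ + (⟦ small (P x) ⟧ + ⟦ small (P y) ⟧)))
        ≡⟨ ∑∑-+ (allFin n) (allFin n) _ _ ⟩
      d + ∑ (allFin n) (λ x → ∑ (allFin n) λ y → ⟦ bad (P x) (P y) ⟧ + (⟦ small (P x) ⟧ + ⟦ small (P y) ⟧))
        ≡⟨ cong (d +_) (trans (∑∑-+ (allFin n) (allFin n) _ _) (cong (b +_) (∑∑-+ (allFin n) (allFin n) _ _))) ⟩
      d + (b + (s₁ + s₂)) ∎

  record Good (x y : Fin n) : Set where
    field
      regular : LowerRegular R q L (cell P (P x)) (cell P (P y))
      largeˡ  : n ≤ L * M * # (cell P (P x))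
      largeʳ  : n ≤ L * M * # (cell P (P y))
  open Good

  ¬small⇒large : ∀ a → small a ≡ false → n ≤ L * M * # (cell P a)
  ¬small⇒large a sm = ≤-trans (<⇒≤ (≰⇒> λ le → subst T sm (≤⇒≤ᵇ le))) (≤-reflexive (*-comm (# (cell P a)) (L * M)))

  kept⇒good : ∀ x y → T (R x y) → removed x y ≡ false → Good x y
  kept⇒good x y Rxy kept with R x y
  ... | true with D (P x) (P y) | irregular? R q L (cell P (P x)) (cell P (P y))
                | small (P x) in sx | small (P y) in sy
  ...   | false | no ¬irr | false | false = record
    { regular = ¬irregular⇒regular R q L ¬irr
    ; largeˡ  = ¬small⇒large (P x) sx
    ; largeʳ  = ¬small⇒large (P y) sy }

  Hits : ∀ {k} → Vec (Fin n) k → Set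
  Hits v = ∃ λ i → ∃ λ j → T (removed (lookup v i) (lookup v j))

  scan-row : ∀ {k} x (v : Vec (Fin n) k) → T (allᵇ (R x) v) →
    (∃ λ j → T (removed x (lookup v j))) ⊎ All (Good x) v
  scan-row x []      _ = inj₂ []
  scan-row x (y ∷ v) h with Rxy , h′ ← Equivalence.to T-∧ h with removed x y in kept
  ... | true  = inj₁ (zero , subst T (sym kept) _)
  ... | false with scan-row x v h′
  ...   | inj₁ (j , hit) = inj₁ (suc j , hit)
  ...   | inj₂ goods     = inj₂ (kept⇒good x y Rxy kept ∷ goods)

  scan : ∀ {k} (v : Vec (Fin n) k) → T (cliqueᵇ R v) → Hits v ⊎ AllPairs Good v
  scan []      _ = inj₂ []
  scan (x ∷ v) h with row , h′ ← Equivalence.to T-∧ h with scan-row x v row | scan v h′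
  ... | inj₁ (j , hit) | _                    = inj₁ (zero , suc j , hit)
  ... | inj₂ _         | inj₁ (i , j , hit)   = inj₁ (suc i , suc j , hit)
  ... | inj₂ goods     | inj₂ goodss          = inj₂ (goods ∷ goodss)

  cells : ∀ {k} → Vec (Fin n) k → Vec (Fin n → Bool) k
  cells = Vec.map (cell P ∘ P)

  cells-large : ∀ {k} (v : Vec (Fin n) k) → All (λ x → n ≤ L * M * # (cell P (P x))) v →
    n ^ k ≤ (L * M) ^ k * sizes (cells v)
  cells-large []      []               = ≤-refl
  cells-large {suc k} (x ∷ v) (large ∷ larges) =
    ≤-trans (*-mono-≤ large (cells-large v larges))
      (≤-reflexive (arrange (L * M) (# (cell P (P x))) ((L * M) ^ k) (sizes (cells v))))
    where
    arrange : ∀ a b c d → a * b * (c * d) ≡ a * c * (b * d)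
    arrange = solve-∀

many-cliques : ∀ {n} (R : Fin n → Fin n → Bool) t {k} (As : Vec (Fin n → Bool) k) →
  AllPairs (LowerRegular R (regularityConst t k) t) As → sizes As ≤ cliqueConst t k * count {k = k} (cliqueᵇ R)
many-cliques {n} R t {k} As regs = ≤-trans (counting R t As regs)
  (*-monoʳ-≤ (cliqueConst t k) (∑-mono (vecs n k) λ v → forget (v ∈ᵖ As) (cliqueᵇ R v)))
  where
  forget : ∀ a b → ⟦ a ∧ b ⟧ ≤ ⟦ b ⟧
  forget true  b = ≤-refl
  forget false b = z≤n

1≤regularityConst : ∀ t k → 1 ≤ regularityConst t k
1≤regularityConst t zero    = ≤-refl
1≤regularityConst t (suc k) = s≤s z≤n

-- A single clique without a removed pair suffices for many cliques: the cells of its vertices are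
-- pairwise lower-regular and have at least n/(tM) vertices each, so `counting` applies to them.
clean : ∀ {n M} r t (R : Fin n → Fin n → Bool) → 1 ≤ M →
  RegularPartition R t (regularityConst t (2 + r)) t M →
  n ^ (2 + r) ≤ (t * M) ^ (2 + r) * cliqueConst t (2 + r) * count {k = 2 + r} (cliqueᵇ R) ⊎
  ∃ λ (E : Fin n → Fin n → Bool) → t * pairs E ≤ 4 * (n * n) × (∀ x y → T (E x y) → T (R x y)) ×
    ∀ (v : Vec (Fin n) (2 + r)) → T (cliqueᵇ R v) → ∃ λ i → ∃ λ j → T (E (lookup v i) (lookup v j))
clean {n} {M} r t R 1≤M ρ with n ^ (2 + r) ≤? (t * M) ^ (2 + r) * cliqueConst t (2 + r) * count {k = 2 + r} (cliqueᵇ R)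
... | yes many = inj₁ many
... | no  few  = inj₂ (removed , removed-few , (λ x y → proj₁ ∘ Equivalence.to T-∧) , λ v h → [ id , (λ goodss → contradiction (many v goodss) few) ]′ (scan v h))
  where
  open Cleaning R 1≤M ρ
  many : ∀ v → AllPairs Good v →
    n ^ (2 + r) ≤ (t * M) ^ (2 + r) * cliqueConst t (2 + r) * count {k = 2 + r} (cliqueᵇ R)
  -- Largeness of cells is known only through pairs of vertices, so at least two vertices are
  -- needed: the first pair gives the first cell, and the pairs with the first vertex give the
  -- others.
  many v@(_ ∷ _ ∷ _) goodss@((good ∷ goods) ∷ _) = begin
    n ^ (2 + r)
      ≤⟨ cells-large v (Good.largeˡ good ∷ All.map Good.largeʳ (good ∷ goods)) ⟩
    (t * M) ^ (2 + r) * sizes (cells v)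
      ≤⟨ *-monoʳ-≤ ((t * M) ^ (2 + r)) (many-cliques R t (cells v) (AllPairs.map⁺ (AllPairs.map Good.regular goodss))) ⟩
    (t * M) ^ (2 + r) * (cliqueConst t (2 + r) * count {k = 2 + r} (cliqueᵇ R))
      ≡⟨ *-assoc ((t * M) ^ (2 + r)) (cliqueConst t (2 + r)) _ ⟨
    (t * M) ^ (2 + r) * cliqueConst t (2 + r) * count {k = 2 + r} (cliqueᵇ R) ∎
    where open ≤-Reasoning

-- Clique removal as an alternative, with `K` depending on `r` and `L` only. Taking `t = 4 * L`
-- absorbs the factor 4 from `removed-few`.
removal : ∀ r L → ∃ λ K → ∀ {n} (R : Fin n → Fin n → Bool) →
  n ^ (2 + r) ≤ K * count {k = 2 + r} (cliqueᵇ R) ⊎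
  ∃ λ (E : Fin n → Fin n → Bool) → L * pairs E ≤ n * n × (∀ x y → T (E x y) → T (R x y)) ×
    ∀ (v : Vec (Fin n) (2 + r)) → T (cliqueᵇ R v) → ∃ λ i → ∃ λ j → T (E (lookup v i) (lookup v j))
removal r L = (t * M) ^ (2 + r) * cliqueConst t (2 + r) , λ R →
  map₂ (λ (E , few , E⊆R , hits) →
         E , *-cancelˡ-≤ 4 (≤-trans (≤-reflexive (sym (*-assoc 4 L (pairs E)))) few) , E⊆R , hits)
       (clean r t R (m≤cellBound (t * q) 1) (regularPartition R t q t (1≤regularityConst t (2 + r))))
  where
  t q M : ℕ
  t = 4 * L
  q = regularityConst t (2 + r)
  M = cellBound (t * q) 1

-- Cliques as sets and as tuples

∈-vecs : ∀ {k} (v : Vec (Fin n) k) → v ∈ vecs n k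
∈-vecs []      = here refl
∈-vecs (x ∷ v) = ∈-cartesianProductWith⁺ _∷_ (∈-allFin x) (∈-vecs v)

-- No subset is listed twice, so a tuple can account for only one clique when its range is compared
-- with all subsets.
∑-allSubsets-δ : (S : Subset n) → ∑ (allSubsets n) (λ S′ → ⟦ does (≡-dec _≟ᵇ_ S S′) ⟧) ≤ 1
∑-allSubsets-δ []              = ≤-refl
∑-allSubsets-δ {suc n} (b ∷ S) = begin
  ∑ (allSubsets (suc n)) (λ S′ → ⟦ does (≡-dec _≟ᵇ_ (b ∷ S) S′) ⟧)
    ≡⟨ trans (∑-++ (map (true ∷_) (allSubsets n)) _ _)
         (cong₂ _+_ (∑-map (true ∷_) (allSubsets n) _) (∑-map (false ∷_) (allSubsets n) _)) ⟩
  ∑ (allSubsets n) (λ S′ → ⟦ does (≡-dec _≟ᵇ_ (b ∷ S) (true ∷ S′)) ⟧) +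
  ∑ (allSubsets n) (λ S′ → ⟦ does (≡-dec _≟ᵇ_ (b ∷ S) (false ∷ S′)) ⟧)
    ≤⟨ halves b ⟩
  1 ∎
  where
  open ≤-Reasoning
  ∑0 : ∑ (allSubsets n) (λ _ → 0) ≡ 0
  ∑0 = trans (∑-const (allSubsets n) 0) (*-zeroʳ (length (allSubsets n)))
  δ : ℕ
  δ = ∑ (allSubsets n) (λ S′ → ⟦ does (≡-dec _≟ᵇ_ S S′) ⟧)
  halves : ∀ b → ∑ (allSubsets n) (λ S′ → ⟦ does (≡-dec _≟ᵇ_ (b ∷ S) (true ∷ S′)) ⟧) +
                 ∑ (allSubsets n) (λ S′ → ⟦ does (≡-dec _≟ᵇ_ (b ∷ S) (false ∷ S′)) ⟧) ≤ 1
  halves true  = ≤-trans (≤-reflexive (trans (cong (δ +_) ∑0) (+-identityʳ δ))) (∑-allSubsets-δ S)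
  halves false = ≤-trans (≤-reflexive (cong (_+ δ) ∑0)) (∑-allSubsets-δ S)

record Enumeration (S : Subset n) {k} (v : Vec (Fin n) k) : Set where
  field
    members    : ∀ y → lookup S y ≡ y ∈ᵇ v
    noRepeats  : repeats v ≡ false
open Enumeration

∣remove∣ : (S : Subset n) (x : Fin n) → lookup S x ≡ true → ∣ S ∣ ≡ suc ∣ S [ x ]≔ false ∣
∣remove∣ (true  ∷ S) zero    _   = refl
∣remove∣ (true  ∷ S) (suc x) x∈S = cong suc (∣remove∣ S x x∈S)
∣remove∣ (false ∷ S) (suc x) x∈S = ∣remove∣ S x x∈S

enumeration-∷ : ∀ {S : Subset n} {x k} {v : Vec (Fin n) k} → lookup S x ≡ true →
                Enumeration (S [ x ]≔ false) v → Enumeration S (x ∷ v)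
enumeration-∷ {S = S} {x} x∈S e .members y with y F.≟ x
... | yes refl = x∈S
... | no  y≢x  = trans (sym (lookup∘update′ y≢x S false)) (members e y)
enumeration-∷ {S = S} {x} {v = v} x∈S e .noRepeats =
  trans (cong (_∨ repeats v) (trans (sym (members e x)) (lookup∘update x S false))) (noRepeats e)

member : ∀ {k} (S : Subset n) → ∣ S ∣ ≡ suc k → ∃ λ x → lookup S x ≡ true
member (true  ∷ S) _  = zero , refl
member (false ∷ S) eq with x , x∈S ← member S eq = suc x , x∈S

enumerate : ∀ k (S : Subset n) → ∣ S ∣ ≡ k → ∃ λ (v : Vec (Fin n) k) → Enumeration S v
enumerate zero S ∣S∣≡0 = [] , record { members = empty S ∣S∣≡0 ; noRepeats = refl }
  where
  empty : ∀ {n} (S : Subset n) → ∣ S ∣ ≡ 0 → ∀ y → lookup S y ≡ false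
  empty (false ∷ S) eq zero    = refl
  empty (false ∷ S) eq (suc y) = empty S eq y
enumerate (suc k) S ∣S∣≡ with x , x∈S ← member S ∣S∣≡
  with v , e ← enumerate k (S [ x ]≔ false) (suc-injective (trans (sym (∣remove∣ S x x∈S)) ∣S∣≡)) =
  x ∷ v , enumeration-∷ x∈S e

enumerateFrom : ∀ k (S : Subset n) {x y} → ∣ S ∣ ≡ suc (suc k) → lookup S x ≡ true → lookup S y ≡ true → x ≢ y →
  ∃ λ (v : Vec (Fin n) k) → Enumeration S (x ∷ y ∷ v)
enumerateFrom k S {x} {y} ∣S∣≡ x∈S y∈S x≢y
  with y∈S′ ← trans (lookup∘update′ (x≢y ∘ sym) S false) y∈S
  with v , e ← enumerate k ((S [ x ]≔ false) [ y ]≔ false)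
         (suc-injective (trans (sym (∣remove∣ (S [ x ]≔ false) y y∈S′))
           (suc-injective (trans (sym (∣remove∣ S x x∈S)) ∣S∣≡)))) =
  v , enumeration-∷ x∈S (enumeration-∷ y∈S′ e)

module _ {n : ℕ} (G : Graph n) where

  adj⇒≢ : ∀ {x y} → T (adj G x y) → x ≢ y
  adj⇒≢ {x} h refl = subst T (irrefl G x) h

  clique-adj : ∀ {k} (v : Vec (Fin n) k) → T (cliqueᵇ (adj G) v) →
               ∀ {i j} → i ≢ j → T (adj G (lookup v i) (lookup v j))
  clique-adj (x ∷ v) h {zero}  {zero}  i≢j = contradiction refl i≢j
  clique-adj (x ∷ v) h {zero}  {suc j} i≢j = T-allᵇ (adj G x) v (proj₁ (Equivalence.to T-∧ h)) j
  clique-adj (x ∷ v) h {suc i} {zero}  i≢j =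
    subst T (adj-sym G x (lookup v i)) (T-allᵇ (adj G x) v (proj₁ (Equivalence.to T-∧ h)) i)
  clique-adj (x ∷ v) h {suc i} {suc j} i≢j = clique-adj v (proj₂ (Equivalence.to (T-∧ {allᵇ (adj G x) v}) h)) (i≢j ∘ cong suc)

  adjacent : ∀ S → T (isCliqueB G S) → ∀ {x y} → lookup S x ≡ true → lookup S y ≡ true → x ≢ y → T (adj G x y)
  adjacent S h {x} {y} x∈S y∈S x≢y = conclude
    (ListAll.lookup (ListAll.all⁺ (rule x) (allFin n)
      (ListAll.lookup (ListAll.all⁺ (λ i → all (rule i) (allFin n)) (allFin n) h) (∈-allFin x))) (∈-allFin y))
    where
    rule : Fin n → Fin n → Bool
    rule i j = not (lookup S i ∧ lookup S j ∧ not ⌊ i F.≟ j ⌋) ∨ adj G i j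
    conclude : T (rule x y) → T (adj G x y)
    conclude t rewrite x∈S | y∈S with x F.≟ y
    ... | yes x≡y = contradiction x≡y x≢y
    ... | no _    = t

  enumeration⇒clique : ∀ S {k} {v : Vec (Fin n) k} → T (isCliqueB G S) → Enumeration S v → T (cliqueᵇ (adj G) v)
  enumeration⇒clique S {v = v₀} h e = go v₀ (λ i → trans (members e (lookup v₀ i)) (∈ᵇ-lookup v₀ i)) (noRepeats e)
    where
    row : ∀ {k} x (v : Vec (Fin n) k) → lookup S x ≡ true → (∀ i → lookup S (lookup v i) ≡ true) →
          x ∈ᵇ v ≡ false → T (allᵇ (adj G x) v)
    row x []      _   _   _ = _
    row x (y ∷ v) x∈S v⊆S x∉ with x F.≟ y
    ... | no x≢y = Equivalence.from T-∧ (adjacent S h x∈S (v⊆S zero) x≢y , row x v x∈S (v⊆S ∘ suc) x∉)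
    go : ∀ {k} (v : Vec (Fin n) k) → (∀ i → lookup S (lookup v i) ≡ true) → repeats v ≡ false → T (cliqueᵇ (adj G) v)
    go []      _   _ = _
    go (x ∷ v) v⊆S rep with x ∈ᵇ v in x∉v
    ... | false = Equivalence.from T-∧ (row x v (v⊆S zero) (v⊆S ∘ suc) x∉v , go v (v⊆S ∘ suc) rep)

  headed : ∀ {k} → (Fin n → Fin n → Bool) → Vec (Fin n) (suc (suc k)) → Bool
  headed E v@(x ∷ y ∷ _) = cliqueᵇ (adj G) v ∧ E x y

  -- A clique can be enumerated so that one of its pairs in E comes first.
  copies≤ : ∀ k (E : Fin n → Fin n → Bool) → (∀ x y → T (E x y) → T (adj G x y)) →
    (∀ (v : Vec (Fin n) (suc (suc k))) → T (cliqueᵇ (adj G) v) → ∃ λ i → ∃ λ j → T (E (lookup v i) (lookup v j))) →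
    copiesK G (suc (suc k)) ≤ count {k = suc (suc k)} (headed E)
  copies≤ k E E⊆adj hits = begin
    copiesK G r
      ≡⟨ sum-map (allSubsets n) (λ S → ⟦ ⌊ ∣ S ∣ ≟ r ⌋ ∧ isCliqueB G S ⟧) ⟩
    ∑ (allSubsets n) (λ S → ⟦ ⌊ ∣ S ∣ ≟ r ⌋ ∧ isCliqueB G S ⟧)
      ≤⟨ ∑-mono (allSubsets n) represented ⟩
    ∑ (allSubsets n) (λ S → ∑ (vecs n r) λ v → ⟦ headed E v ⟧ * ⟦ does (≡-dec _≟ᵇ_ (range v) S) ⟧)
      ≡⟨ ∑-comm (allSubsets n) (vecs n r) _ ⟩
    ∑ (vecs n r) (λ v → ∑ (allSubsets n) λ S → ⟦ headed E v ⟧ * ⟦ does (≡-dec _≟ᵇ_ (range v) S) ⟧)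
      ≡⟨ ∑-cong (vecs n r) (λ v → ∑-*ˡ (allSubsets n) ⟦ headed E v ⟧ _) ⟩
    ∑ (vecs n r) (λ v → ⟦ headed E v ⟧ * ∑ (allSubsets n) λ S → ⟦ does (≡-dec _≟ᵇ_ (range v) S) ⟧)
      ≤⟨ ∑-mono (vecs n r) (λ v → *-monoʳ-≤ ⟦ headed E v ⟧ (∑-allSubsets-δ (range v))) ⟩
    ∑ (vecs n r) (λ v → ⟦ headed E v ⟧ * 1)
      ≡⟨ ∑-cong (vecs n r) (λ v → *-identityʳ ⟦ headed E v ⟧) ⟩
    count {k = r} (headed E) ∎
    where
    open ≤-Reasoning
    r : ℕ
    r = suc (suc k)
    -- Every clique is the range of some headed tuple and every tuple has one range, so double
    -- counting the pairs `(S, v)` with `range v ≡ S` gives the bound.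
    range : Vec (Fin n) r → Subset n
    range v = tabulate (_∈ᵇ v)
    range-enumeration : ∀ {S v} → Enumeration S v → range v ≡ S
    range-enumeration {S} e = trans (tabulate-cong (sym ∘ members e)) (tabulate∘lookup S)
    represent : ∀ S → ∣ S ∣ ≡ r → T (isCliqueB G S) → ∃ λ v → T (headed E v) × range v ≡ S
    represent S ∣S∣≡r h = head-first (enumerate r S ∣S∣≡r)
      where
      head-first : (∃ λ (v : Vec (Fin n) r) → Enumeration S v) → ∃ λ v → T (headed E v) × range v ≡ S
      head-first (v , e) = let
        i , j , Eij = hits v (enumeration⇒clique S h e)
        x = lookup v i
        y = lookup v j
        ∈S i = trans (members e (lookup v i)) (∈ᵇ-lookup v i)
        w , e′ = enumerateFrom k S {x} {y} ∣S∣≡r (∈S i) (∈S j) (adj⇒≢ (E⊆adj x y Eij))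
        in x ∷ y ∷ w
         , Equivalence.from (T-∧ {cliqueᵇ (adj G) (x ∷ y ∷ w)}) (enumeration⇒clique S h e′ , Eij)
         , range-enumeration e′
    hit : Subset n → Vec (Fin n) r → ℕ
    hit S v = ⟦ headed E v ⟧ * ⟦ does (≡-dec _≟ᵇ_ (range v) S) ⟧
    1≤hits : ∀ S → (∃ λ v → T (headed E v) × range v ≡ S) → 1 ≤ ∑ (vecs n r) (hit S)
    1≤hits S (v , hv , eq) =
      ≤-trans (≤-reflexive (sym (cong₂ (λ a b → ⟦ a ⟧ * ⟦ b ⟧) (Equivalence.to T-≡ hv) (dec-true (≡-dec _≟ᵇ_ (range v) S) eq))))
              (∑-∈ (hit S) (∈-vecs v))
    represented : ∀ S → ⟦ ⌊ ∣ S ∣ ≟ r ⌋ ∧ isCliqueB G S ⟧ ≤ ∑ (vecs n r) (hit S)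
    represented S with ∣ S ∣ ≟ r | isCliqueB G S in clique
    ... | no _      | _     = z≤n
    ... | yes _     | false = z≤n
    ... | yes ∣S∣≡r | true  = 1≤hits S (represent S ∣S∣≡r (subst T (sym clique) _))

  -- Two vertices in different parts extend to a transversal, which is a clique by `complete`, so
  -- they are adjacent. Irreflexivity then makes different parts disjoint.
  blowup⇒Kpartite : ∀ r {s : Fin (suc r) → ℕ} {H} → (∀ i → 1 ≤ s i) →
    (∀ v → T (H v) → T (cliqueᵇ (adj G) v)) → Blowup r s H → ContainsKpartite G (suc r) s
  blowup⇒Kpartite r {s} {H} 1≤s H⇒clique b = f , f-injective , f-adj
    where
    f : KVertex (suc r) s → Fin n
    f (i , a) = Blowup.part b i a
    -- The transversal through `p` and `q`; other parts contribute their first vertex, which exists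
    -- as sizes are positive. `p` takes precedence, so `q` lies on it only if the parts differ.
    choose : (p q : KVertex (suc r) s) → ∀ i → Fin (s i)
    choose (i , a) (j , b) k with k F.≟ i | k F.≟ j
    ... | yes refl | _        = a
    ... | no _     | yes refl = b
    ... | no _     | no _     = fromℕ< (1≤s k)
    choose₁ : ∀ p q → choose p q (proj₁ p) ≡ proj₂ p
    choose₁ (i , a) (j , b) with i F.≟ i | i F.≟ j
    ... | yes refl | _ = refl
    ... | no i≢i   | _ = contradiction refl i≢i
    choose₂ : ∀ p q → proj₁ p ≢ proj₁ q → choose p q (proj₁ q) ≡ proj₂ q
    choose₂ (i , a) (j , b) i≢j with j F.≟ i | j F.≟ j
    ... | yes refl | _        = contradiction refl i≢j
    ... | no _     | yes refl = refl
    ... | no _     | no j≢j   = contradiction refl j≢j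
    f-adj : ∀ p q → proj₁ p ≢ proj₁ q → T (adj G (f p) (f q))
    f-adj p q p≢q = subst₂ (λ x y → T (adj G x y))
      (trans (lookup∘tabulate g (proj₁ p)) (cong (Blowup.part b (proj₁ p)) (choose₁ p q)))
      (trans (lookup∘tabulate g (proj₁ q)) (cong (Blowup.part b (proj₁ q)) (choose₂ p q p≢q)))
      (clique-adj (tabulate g) (H⇒clique (tabulate g) (Blowup.complete b (choose p q))) p≢q)
      where
      g : Fin (suc r) → Fin n
      g i = Blowup.part b i (choose p q i)
    f-injective : Injective _≡_ _≡_ f
    f-injective {i , a} {j , b′} eq with i F.≟ j
    ... | yes refl = cong (i ,_) (Blowup.injective b i eq)
    ... | no  i≢j  = contradiction eq (adj⇒≢ (f-adj (i , a) (j , b′) i≢j))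

-- Combining the bounds.

sizeProd≡prodButLast : ∀ r (s : Fin (suc r) → ℕ) → prodButLast (suc r) s ≡ sizeProd r s
sizeProd≡prodButLast zero    s = refl
sizeProd≡prodButLast (suc r) s = cong (s zero *_) (trans
  (cong (foldr _*_ 1) (trans (map-tabulate suc (s ∘ inject₁)) (sym (map-tabulate id (s ∘ inject₁ ∘ suc)))))
  (sizeProd≡prodButLast r (s ∘ suc)))

1≤sizeProd : ∀ r (s : Fin (suc r) → ℕ) → (∀ i → 1 ≤ s i) → 1 ≤ sizeProd r s
1≤sizeProd zero    s 1≤s = ≤-refl
1≤sizeProd (suc r) s 1≤s = *-mono-≤ (1≤s zero) (1≤sizeProd r (s ∘ suc) (1≤s ∘ suc))

-- Here 1/`k` plays the part of ε, and the wanted inequality is raised to the power `p` to clear the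
-- fractional exponent. The number of parts is `3 + r`.
module Conclusion (r : ℕ) (s : Fin (3 + r) → ℕ) (1≤s : ∀ i → 1 ≤ s i) (k : ℕ) where

  p σ K : ℕ
  p = sizeProd (2 + r) s
  σ = sizeSum (2 + r) s
  K = boxConst (2 + r) s

  -- The case of at least n^(3+r)/κ ordered cliques: for `H` the set of all of them, `box-lower` is
  -- of order n^(σ+1) and `box-upper` of order n^σ, which bounds `n`.
  few-cliques : ∀ {n} .{{_ : NonZero n}} (G : Graph n) κ → ¬ ContainsKpartite G _ s →
    n ^ (3 + r) ≤ κ * count {k = 3 + r} (cliqueᵇ (adj G)) → n ≤ κ ^ p * K
  few-cliques {n} G κ ¬K many = *-cancelˡ-≤ (X * n ^ σ) {{m*n≢0 X (n ^ σ) {{m^n≢0 n ((3 + r) * p)}} {{m^n≢0 n σ}}}} (begin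
    X * n ^ σ * n                    ≡⟨ arrange₁ X (n ^ σ) n ⟩
    X * n ^ suc σ                    ≡⟨ cong (_* n ^ suc σ) (^-*-assoc n (3 + r) p) ⟨
    (n ^ (3 + r)) ^ p * n ^ suc σ ≤⟨ *-monoˡ-≤ (n ^ suc σ) (^-monoˡ-≤ p many) ⟩
    (κ * N) ^ p * n ^ suc σ          ≡⟨ cong (_* n ^ suc σ) (^-distribʳ-* p κ N) ⟩
    κ ^ p * N ^ p * n ^ suc σ        ≡⟨ *-assoc (κ ^ p) (N ^ p) _ ⟩
    κ ^ p * (N ^ p * n ^ suc σ)      ≤⟨ *-monoʳ-≤ (κ ^ p) (box-lower (2 + r) s H) ⟩
    κ ^ p * (X * β)                  ≤⟨ *-monoʳ-≤ (κ ^ p) (*-monoʳ-≤ X (box-upper (2 + r) s H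
                                          (¬K ∘ blowup⇒Kpartite G (2 + r) 1≤s (λ _ → id)))) ⟩
    κ ^ p * (X * (K * n ^ σ))        ≡⟨ arrange₂ (κ ^ p) X K (n ^ σ) ⟩
    X * n ^ σ * (κ ^ p * K)          ∎)
    where
    open ≤-Reasoning
    H : Vec (Fin n) (3 + r) → Bool
    H = cliqueᵇ (adj G)
    N X β : ℕ
    N = count {k = 3 + r} H
    X = n ^ ((3 + r) * p)
    β = box (2 + r) s H
    arrange₁ : ∀ a b c → a * b * c ≡ a * (c * b)
    arrange₁ = solve-∀
    arrange₂ : ∀ a b c d → a * (b * (c * d)) ≡ b * d * (a * c)
    arrange₂ = solve-∀

  -- The other case, with `H` the cliques headed by a pair of `E`. The density 1/(k^p K) allowed for
  -- `E` is what cancels both the constant `K` and the factor `k ^ p`.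
  few-copies : ∀ {n} .{{_ : NonZero n}} (G : Graph n) → ¬ ContainsKpartite G _ s →
    (E : Fin n → Fin n → Bool) → k ^ p * K * pairs E ≤ n * n →
    copiesK G (3 + r) ≤ count {k = 3 + r} (headed G E) →
    (k * copiesK G (3 + r)) ^ p * n ≤ n ^ ((3 + r) * p)
  few-copies {n} G ¬K E few copies≤N = *-cancelʳ-≤ _ _ (n ^ σ * (n * n))
    {{m*n≢0 (n ^ σ) (n * n) {{m^n≢0 n σ}} {{m*n≢0 n n}}}} (begin
    (k * c) ^ p * n * (n ^ σ * (n * n))  ≡⟨ arrange₁ ((k * c) ^ p) n (n ^ σ) ⟩
    n * n * ((k * c) ^ p * n ^ suc σ)    ≤⟨ *-monoʳ-≤ (n * n) (*-monoˡ-≤ (n ^ suc σ) (^-monoˡ-≤ p (*-monoʳ-≤ k copies≤N))) ⟩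
    n * n * ((k * N) ^ p * n ^ suc σ)    ≡⟨ cong (λ a → n * n * (a * n ^ suc σ)) (^-distribʳ-* p k N) ⟩
    n * n * (k ^ p * N ^ p * n ^ suc σ)  ≡⟨ cong (n * n *_) (*-assoc (k ^ p) (N ^ p) _) ⟩
    n * n * (k ^ p * (N ^ p * n ^ suc σ)) ≤⟨ *-monoʳ-≤ (n * n) (*-monoʳ-≤ (k ^ p) (box-lower (2 + r) s H)) ⟩
    n * n * (k ^ p * (X * β))            ≡⟨ arrange₂ (n * n) (k ^ p) X β ⟩
    k ^ p * X * (n * n * β)              ≤⟨ *-monoʳ-≤ (k ^ p * X) (box-upper-pairs 1≤s H
                                              (¬K ∘ blowup⇒Kpartite G (2 + r) 1≤s H⇒clique) E E-false) ⟩
    k ^ p * X * (pairs E * (K * n ^ σ))  ≡⟨ arrange₃ (k ^ p) X (pairs E) K (n ^ σ) ⟩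
    X * (n ^ σ * (k ^ p * K * pairs E))  ≤⟨ *-monoʳ-≤ X (*-monoʳ-≤ (n ^ σ) few) ⟩
    X * (n ^ σ * (n * n))                ∎)
    where
    open ≤-Reasoning
    H : Vec (Fin n) (3 + r) → Bool
    H = headed G E
    c N X β : ℕ
    c = copiesK G (3 + r)
    N = count {k = 3 + r} H
    X = n ^ ((3 + r) * p)
    β = box (2 + r) s H
    H⇒clique : ∀ v → T (H v) → T (cliqueᵇ (adj G) v)
    H⇒clique (x ∷ y ∷ v) = proj₁ ∘ Equivalence.to T-∧
    E-false : ∀ x y v → E x y ≡ false → H (x ∷ y ∷ v) ≡ false
    E-false x y v Exy = trans (cong (cliqueᵇ (adj G) (x ∷ y ∷ v) ∧_) Exy) (∧-zeroʳ _)
    arrange₁ : ∀ a n b → a * n * (b * (n * n)) ≡ n * n * (a * (n * b))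
    arrange₁ = solve-∀
    arrange₂ : ∀ m a b c → m * (a * (b * c)) ≡ a * b * (m * c)
    arrange₂ = solve-∀
    arrange₃ : ∀ a x e k m → a * x * (e * (k * m)) ≡ x * (m * (a * k * e))
    arrange₃ = solve-∀

  -- The removal parameter is the inverse density asked for by `few-copies`. `N₀` exceeds the bound
  -- of `few-cliques`, and being positive it also makes `n` nonzero.
  κ N₀ : ℕ
  κ  = proj₁ (removal (suc r) (k ^ p * K))
  N₀ = suc (κ ^ p * K)

  bound : ∀ n → N₀ ≤ n → (G : Graph n) → ¬ ContainsKpartite G _ s →
    (k * copiesK G (3 + r)) ^ p * n ≤ n ^ ((3 + r) * p)
  bound n@(suc _) N₀≤n G ¬K with proj₂ (removal (suc r) (k ^ p * K)) (adj G)
  ... | inj₁ many = contradiction (few-cliques G κ ¬K many) (<⇒≱ N₀≤n)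
  ... | inj₂ (E , few , E⊆adj , hits) = few-copies G ¬K E few (copies≤ G (suc r) E E⊆adj hits)

theorem1p1 : (r : ℕ) → 3 ≤ r → (s : Fin r → ℕ) → (∀ i → 1 ≤ s i) → (∀ i j → i F.≤ j → s i ≤ s j) → ∀ (k : ℕ) → 1 ≤ k → ∃ λ (N : ℕ) → ∀ (n : ℕ) → N ≤ n → ∀ (G : Graph n) → ¬ ContainsKpartite G r s → (k * copiesK G r) ^ prodButLast r s ≤ n ^ (r * prodButLast r s ∸ 1)
theorem1p1 (suc zero) (s≤s ())
theorem1p1 (suc (suc zero)) (s≤s (s≤s ()))
theorem1p1 (suc (suc (suc r))) _ s 1≤s _ k _ = N₀ , λ n N₀≤n G ¬K →
  subst (λ p → (k * copiesK G (3 + r)) ^ p ≤ n ^ ((3 + r) * p ∸ 1)) (sym (sizeProd≡prodButLast (2 + r) s))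
    (divide n N₀≤n (bound n N₀≤n G ¬K))
  where
  open Conclusion r s 1≤s k
  -- Cancels one factor `n`. The truncated subtraction is exact because `p` is positive.
  divide : ∀ n {a} → N₀ ≤ n → a * n ≤ n ^ ((3 + r) * p) → a ≤ n ^ ((3 + r) * p ∸ 1)
  divide n@(suc _) {a} _ le = *-cancelʳ-≤ a _ n (≤-trans le (≤-reflexive (begin
    n ^ ((3 + r) * p)             ≡⟨ cong (n ^_) (m∸n+n≡m (*-mono-≤ {1} {3 + r} (s≤s z≤n) (1≤sizeProd (2 + r) s 1≤s))) ⟨
    n ^ ((3 + r) * p ∸ 1 + 1)     ≡⟨ ^-distribˡ-+-* n ((3 + r) * p ∸ 1) 1 ⟩
    n ^ ((3 + r) * p ∸ 1) * n ^ 1 ≡⟨ cong (n ^ ((3 + r) * p ∸ 1) *_) (*-identityʳ n) ⟩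
    n ^ ((3 + r) * p ∸ 1) * n     ∎)))
    where open ≡-Reasoning
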